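{- For every composition $\eta$, the bar monomial $x^{\underline\eta}$ is the unique polynomial $g$ such that (1) $g-x^\eta$ has degree $<|\eta|$, and (2) $g(-\overline\gamma)=0$ for all compositions $\gamma$ with $|\gamma|<|\eta|$.
   Context: Fix $n\ge1$; $r$ is an indeterminate, $\alpha=1/r$, $\mathbb{F}=\mathbb{Q}(r)$, polynomials in $\mathbb{F}[x_1,\dots,x_n]$. Compositions are $\eta\in\mathbb{N}^n$, $|\eta|=\sum\eta_i$, $x^\eta=\prod x_i^{\eta_i}$; partitions are weakly decreasing compositions; $\delta=(n-1,\dots,0)$; permutations act on vectors by $(wv)_{w(i)}=v_i$; $w_\gamma$ is the minimal-length permutation with $w_\gamma^{ -1}(\gamma)$ a partition, $\overline\gamma=\gamma+w_\gamma(r\delta)$. $E_\eta^{r\delta}$ is the unique polynomial of degree $|\eta|$ vanishing at all $\overline\gamma$ with $\gamma\ne\eta$, $|\gamma|\le|\eta|$, with coefficient $1$ on $x^\eta$; $E_\eta^{(\alpha)}$ its top homogeneous component. With $a_\eta(i,j)=\eta_i-j$, $l_\eta(i,j)=\#\{k>i:j\le\eta_k\le\eta_i\}+\#\{k<i:j\le\eta_k+1\le\eta_i\}$, $d_\eta(\alpha)=\prod_{1\le j\le\eta_i}(\alpha(a_\eta(i,j)+1)+l_\eta(i,j)+1)$, set $F_\eta^{(\alpha)}=d_\eta E_\eta^{(\alpha)}$, $F_\eta^{r\delta}(x)=(-1)^{|\eta|}d_\eta E_\eta^{r\delta}(-x)$; $\Xi$ is the unique $\mathbb{F}$-linear operator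 with $\Xi(F_\eta^{(\alpha)})=F_\eta^{r\delta}$; the bar monomial is $x^{\underline\eta}=\Xi(x^\eta)$. -}

module Defs where

open import Data.Nat as ℕ using (ℕ; zero; suc; _∸_)
open import Data.Rational as Q using (ℚ; 0ℚ; 1ℚ)
import Data.Integer
open import Data.List as L using (List; []; _∷_; filter; map; foldr; length; upTo; allFin; concatMap)
open import Data.List.Relation.Unary.All using (All)
open import Data.Vec as V using (Vec; []; _∷_)
open import Data.Vec.Properties using (≡-dec)
open import Data.Fin as Fin using (Fin)
open import Data.Product using (Σ; _×_; _,_; ∃)
open import Relation.Nullary using (¬_; yes; no)
open import Relation.Nullary.Decidable using (_×-dec_)
open import Relation.Binary.PropositionalEquality using (_≡_)

QPoly : Set
QPoly = List ℚ

coeffQ : QPoly → ℕ → ℚ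
coeffQ []       _       = 0ℚ
coeffQ (a ∷ p)  zero    = a
coeffQ (a ∷ p)  (suc k) = coeffQ p k

_≈P_ : QPoly → QPoly → Set
p ≈P q = ∀ k → coeffQ p k ≡ coeffQ q k

_+P_ : QPoly → QPoly → QPoly
[]      +P q       = q
(a ∷ p) +P []      = a ∷ p
(a ∷ p) +P (b ∷ q) = (a Q.+ b) ∷ (p +P q)

negP : QPoly → QPoly
negP = map (λ a → Q.- a)

_*P_ : QPoly → QPoly → QPoly
[]      *P q = []
(a ∷ p) *P q = map (a Q.*_) q +P (0ℚ ∷ (p *P q))

-- 𝔽 = ℚ(r) : fractions num/den.  Field equality is cross-multiplication.
-- An element is *valid* when its denominator is a nonzero polynomial;
-- every element built by the operations below from valid elements is
-- valid (ℚ[r] is an integral domain), and quantified elements are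
-- required to be valid.

record 𝔽 : Set where
  constructor _/_
  field
    num : QPoly
    den : QPoly
open 𝔽 public

Valid : 𝔽 → Set
Valid a = ¬ (den a ≈P [])

_≈F_ : 𝔽 → 𝔽 → Set
a ≈F b = (num a *P den b) ≈P (num b *P den a)

fromℚ : ℚ → 𝔽
fromℚ q = (q ∷ []) / (1ℚ ∷ [])

fromℕF : ℕ → 𝔽
fromℕF k = fromℚ (Data.Integer.+ k Q./ 1)

0F 1F : 𝔽
0F = fromℚ 0ℚ
1F = fromℚ 1ℚ

rF αF : 𝔽
rF = (0ℚ ∷ 1ℚ ∷ []) / (1ℚ ∷ [])
αF = (1ℚ ∷ []) / (0ℚ ∷ 1ℚ ∷ [])

_+F_ : 𝔽 → 𝔽 → 𝔽
a +F b = ((num a *P den b) +P (num b *P den a)) / (den a *P den b)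

_*F_ : 𝔽 → 𝔽 → 𝔽
a *F b = (num a *P num b) / (den a *P den b)

-F_ : 𝔽 → 𝔽
-F a = negP (num a) / den a

_^F_ : 𝔽 → ℕ → 𝔽
a ^F zero  = 1F
a ^F suc k = a *F (a ^F k)

sumF prodF : List 𝔽 → 𝔽
sumF  = foldr _+F_ 0F
prodF = foldr _*F_ 1F

Comp : ℕ → Set
Comp n = Vec ℕ n

∣_∣ : ∀ {n} → Comp n → ℕ
∣ η ∣ = V.sum η

MPoly : ℕ → Set
MPoly n = List (𝔽 × Comp n)

ValidM : ∀ {n} → MPoly n → Set
ValidM p = All (λ t → Valid (Data.Product.proj₁ t)) p

coeffM : ∀ {n} → MPoly n → Comp n → 𝔽
coeffM []            m = 0F
coeffM ((c , m') ∷ p) m with ≡-dec ℕ._≟_ m' m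
... | yes _ = c +F coeffM p m
... | no  _ = coeffM p m

_≈M_ : ∀ {n} → MPoly n → MPoly n → Set
p ≈M q = ∀ m → coeffM p m ≈F coeffM q m

monoM : ∀ {n} → Comp n → MPoly n
monoM η = (1F , η) ∷ []

_+M_ : ∀ {n} → MPoly n → MPoly n → MPoly n
_+M_ = L._++_

scaleM : ∀ {n} → 𝔽 → MPoly n → MPoly n
scaleM c = map (λ { (a , m) → (c *F a , m) })

-M_ : ∀ {n} → MPoly n → MPoly n
-M p = scaleM (-F 1F) p

sumM : ∀ {n} → List (MPoly n) → MPoly n
sumM = foldr _+M_ []

negxM : ∀ {n} → MPoly n → MPoly n
negxM = map (λ { (a , m) → (((-F 1F) ^F ∣ m ∣) *F a , m) })

topM : ∀ {n} → ℕ → MPoly n → MPoly n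
topM d = filter (λ t → ∣ Data.Product.proj₂ t ∣ ℕ.≟ d)

-- deg p < d  (every monomial of total degree ≥ d has zero coefficient;
-- for d = 0 this says p = 0)
DegLt : ∀ {n} → MPoly n → ℕ → Set
DegLt p d = ∀ m → d ℕ.≤ ∣ m ∣ → coeffM p m ≈F 0F

DegLe : ∀ {n} → MPoly n → ℕ → Set
DegLe p d = DegLt p (suc d)

monoEval : ∀ {n} → Comp n → Vec 𝔽 n → 𝔽
monoEval m v = prodF (V.toList (V.zipWith _^F_ v m))

evalM : ∀ {n} → MPoly n → Vec 𝔽 n → 𝔽
evalM p v = sumF (map (λ { (c , m) → c *F monoEval m v }) p)

-- γ̄ = γ + w_γ(rδ).  With (wv)_{w(i)} = v_i and w_γ minimal (stable
-- sort into decreasing order), (w_γ δ)_i = n-1-p(i) where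
-- p(i) = #{k : γ_k > γ_i} + #{k < i : γ_k = γ_i}  (0-indexed position
-- of i after sorting).

posγ : ∀ {n} → Comp n → Fin n → ℕ
posγ {n} γ i =
  length (filter (λ k → V.lookup γ i ℕ.<? V.lookup γ k) (allFin n))
  ℕ.+ length (filter (λ k → (k Fin.<? i) ×-dec (V.lookup γ k ℕ.≟ V.lookup γ i)) (allFin n))

bar : ∀ {n} → Comp n → Vec 𝔽 n
bar {n} γ = V.tabulate (λ i →
  fromℕF (V.lookup γ i) +F (rF *F fromℕF ((n ∸ 1) ∸ posγ γ i)))

negV : ∀ {n} → Vec 𝔽 n → Vec 𝔽 n
negV = V.map -F_

legη : ∀ {n} → Comp n → Fin n → ℕ → ℕ
legη {n} η i j =
  length (filter (λ k → (i Fin.<? k) ×-dec ((j ℕ.≤? V.lookup η k) ×-dec (V.lookup η k ℕ.≤? V.lookup η i))) (allFin n))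
  ℕ.+ length (filter (λ k → (k Fin.<? i) ×-dec ((j ℕ.≤? suc (V.lookup η k)) ×-dec (suc (V.lookup η k) ℕ.≤? V.lookup η i))) (allFin n))

armη : ∀ {n} → Comp n → Fin n → ℕ → ℕ
armη η i j = V.lookup η i ∸ j

dη : ∀ {n} → Comp n → 𝔽
dη {n} η = prodF (concatMap (λ i →
  map (λ j → (αF *F fromℕF (suc (armη η i j))) +F fromℕF (suc (legη η i j)))
      (map suc (upTo (V.lookup η i))))
  (allFin n))

IsE : ∀ {n} → Comp n → MPoly n → Set
IsE {n} η p =
  ValidM p × DegLe p ∣ η ∣ × (coeffM p η ≈F 1F)
  × (∀ (γ : Comp n) → ¬ (γ ≡ η) → ∣ γ ∣ ℕ.≤ ∣ η ∣ → evalM p (bar γ) ≈F 0F)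

-- F_γ^{(α)} = d_γ E_γ^{(α)}  (E^{(α)} = top homogeneous component)
Fα : ∀ {n} → Comp n → MPoly n → MPoly n
Fα γ E = scaleM (dη γ) (topM ∣ γ ∣ E)

Frδ : ∀ {n} → Comp n → MPoly n → MPoly n
Frδ γ E = scaleM (((-F 1F) ^F ∣ γ ∣) *F dη γ) (negxM E)

-- Ξ(x^η) = g : x^η = Σ c_k F_{γ_k}^{(α)} and g = Σ c_k F_{γ_k}^{rδ}
-- (Ξ is the linear operator sending F^{(α)}_γ to F^{rδ}_γ).
Term : ℕ → Set
Term n = 𝔽 × Comp n × MPoly n

termOK : ∀ {n} → Term n → Set
termOK (c , γ , E) = Valid c × IsE γ E

termα termrδ : ∀ {n} → Term n → MPoly n
termα  (c , γ , E) = scaleM c (Fα γ E)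
termrδ (c , γ , E) = scaleM c (Frδ γ E)

IsBarMono : ∀ {n} → Comp n → MPoly n → Set
IsBarMono {n} η g = Σ (List (Term n)) λ ts →
  All termOK ts
  × (monoM η ≈M sumM (map termα ts))
  × (g ≈M sumM (map termrδ ts))

Cond : ∀ {n} → Comp n → MPoly n → Set
Cond {n} η g =
  DegLt (g +M (-M monoM η)) ∣ η ∣
  × (∀ (γ : Comp n) → ∣ γ ∣ ℕ.< ∣ η ∣ → evalM g (negV (bar γ)) ≈F 0F)

{-# OPTIONS --safe #-}

-- Interpolation at the points γ̄ has a Newton basis.  Reach γ from 0 by visiting the
-- coordinates cyclically, at each step the free coordinate j placed last in the sorted order
-- of the current composition β, and either freeze it or raise it by one.  All γ that freeze j
-- at β share the entry (β̄)_j in γ̄, so the product N_γ of the factors x_j − (β̄)_j, one for each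
-- raise on the way to γ, vanishes at every node whose path froze a coordinate that the path
-- of γ raised at the same point.  Thus N_γ = x^γ + (lower degree) is triangular for evaluation,
-- with diagonal values products of elements k + 1 + l r, which are nonzero already at r = 0.
-- Consequently a polynomial of degree < d vanishing at all γ̄ with |γ| < d is zero, and every
-- E_γ exists with E_γ(γ̄) ≠ 0.
--
-- If x^η = Σ c_γ F_γ^(α), then for k ≠ |η| the part Σ_{|γ| = k} c_γ d_γ E_γ has degree < k and
-- vanishes at the nodes of size < k, hence is zero; the part k = |η| has top component x^η.
-- So Σ c_γ F_γ^{rδ} is that part, up to the sign (−1)^|η| and x ↦ −x.

module Submission where

open import Defs
open import Data.Product using (Σ; ∃; _×_; _,_; proj₁; proj₂)
open import Data.Nat as ℕ using (ℕ; zero; suc; _∸_; _≤_)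
import Data.Nat.Properties as ℕ
open import Data.Nat.Solver using (module +-*-Solver)
import Data.Integer as ℤ
import Data.Integer.Properties as ℤ
open import Data.Rational as Q using (ℚ; 0ℚ; 1ℚ)
import Data.Rational.Properties as Q
import Data.Rational.Unnormalised as Qᵘ
import Data.Rational.Unnormalised.Properties as Qᵘ
open import Data.Bool using (true; false)
open import Data.Fin as Fin using (Fin)
import Data.Fin.Properties as Fin
open import Data.List as L using (List; []; _∷_; map; _++_; filter; length; allFin)
open import Data.List.Properties using (map-++)
open import Data.List.Membership.Propositional using (_∈_; _∉_; find)
open import Data.List.Membership.Propositional.Properties
  using (∈-map⁺; ∈-++⁺ˡ; ∈-++⁺ʳ; ∈-++⁻; ∈-tabulate⁺)
import Data.List.Membership.DecPropositional as DecMembership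
open import Data.List.Relation.Unary.All as All using (All; []; _∷_)
import Data.List.Relation.Unary.All.Properties as All
open import Data.List.Relation.Unary.AllPairs as AllPairs using (AllPairs; []; _∷_)
import Data.List.Relation.Unary.AllPairs.Properties as AllPairs
open import Data.List.Relation.Unary.Any using (Any; here; there)
import Data.List.Relation.Unary.Any.Properties as Any
open import Data.Sum as Sum using (_⊎_; inj₁; inj₂; [_,_]′)
open import Data.Vec as V using (Vec; []; _∷_; lookup; updateAt)
open import Data.Vec.Properties as V
  using (≡-dec; lookup∘updateAt; lookup∘updateAt′; lookup∘tabulate; tabulate∘lookup;
         tabulate-cong; tabulate-∘; lookup-replicate)
open import Algebra.Bundles using (CommutativeRing)
import Algebra.Properties.Ring as RingProperties
import Algebra.Solver.Ring.NaturalCoefficients.Default as SemiringSolver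
open import Function using (_∘_; id)
open import Level using (0ℓ; _⊔_)
open import Relation.Binary.Definitions using (DecidableEquality)
open import Relation.Binary.PropositionalEquality as ≡ using (_≡_; _≢_)
import Relation.Binary.Reasoning.Setoid as SetoidReasoning
open import Relation.Nullary using (¬_; yes; no; Dec; contradiction)
open import Relation.Unary using (Decidable)

-- Compositions

-- The obstacle is that `bar γ` depends on the sorted order of all of `γ`, so its entries cannot be
-- computed one coordinate at a time. Visiting the free coordinate `j` in last place resolves this.
-- If `j` is raised instead, its place can only move forward, so its multiple of `r` does not
-- decrease while its integer part grows. This is why the values of the factors are `k + 1 + l r`
-- with `l` a natural number, which the substitution `r = 0` shows to be nonzero. The triangular
-- system is solved with explicit inverses over an arbitrary commutative ring. The ring finally used
-- consists of the fractions with nonzero denominator: on all of `𝔽` cross-multiplication is not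
-- transitive, because a fraction with zero numerator and zero denominator is related to everything.

raise : ∀ {n} → Comp n → Fin n → Comp n
raise β j = updateAt β j suc

∣raise∣ : ∀ {n} (β : Comp n) j → ∣ raise β j ∣ ≡ suc ∣ β ∣
∣raise∣ (k ∷ β) Fin.zero    = ≡.refl
∣raise∣ (k ∷ β) (Fin.suc j) = ≡.trans (≡.cong (k ℕ.+_) (∣raise∣ β j)) (ℕ.+-suc k ∣ β ∣)

lookup-raise-≤ : ∀ {n} (β : Comp n) j i → lookup β i ℕ.≤ lookup (raise β j) i
lookup-raise-≤ (k ∷ β) Fin.zero    Fin.zero    = ℕ.n≤1+n k
lookup-raise-≤ (k ∷ β) Fin.zero    (Fin.suc i) = ℕ.≤-refl
lookup-raise-≤ (k ∷ β) (Fin.suc j) Fin.zero    = ℕ.≤-refl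
lookup-raise-≤ (k ∷ β) (Fin.suc j) (Fin.suc i) = lookup-raise-≤ β j i

lookup-raise-≢ : ∀ {n} (β : Comp n) {j i} → i ≢ j → lookup (raise β j) i ≡ lookup β i
lookup-raise-≢ β {j} {i} i≢j = lookup∘updateAt′ i j i≢j β

∣∣-mono : ∀ {n} (β γ : Comp n) → (∀ i → lookup β i ℕ.≤ lookup γ i) → ∣ β ∣ ℕ.≤ ∣ γ ∣
∣∣-mono []      []      β≤γ = ℕ.z≤n
∣∣-mono (k ∷ β) (l ∷ γ) β≤γ = ℕ.+-mono-≤ (β≤γ Fin.zero) (∣∣-mono β γ (β≤γ ∘ Fin.suc))

lookup-ext : ∀ {n} {β γ : Comp n} → (∀ i → lookup β i ≡ lookup γ i) → β ≡ γ
lookup-ext {β = β} {γ} β≗γ =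
  ≡.trans (≡.sym (tabulate∘lookup β)) (≡.trans (tabulate-cong β≗γ) (tabulate∘lookup γ))

-- The compositions γ ≥ β that differ from β only in the coordinates listed in S.
record Above {n} (S : List (Fin n)) (β γ : Comp n) : Set where
  constructor above
  field
    lower  : ∀ i → lookup β i ℕ.≤ lookup γ i
    frozen : ∀ i → i ∉ S → lookup γ i ≡ lookup β i
open Above public

module _ {n : ℕ} {S : List (Fin n)} {β γ : Comp n} {j : Fin n} where

  Above-unfreeze : Above S β γ → Above (j ∷ S) β γ
  Above-unfreeze (above lo fr) = above lo λ i i∉ → fr i (i∉ ∘ there)

  Above-unraise : Above (S ++ j ∷ []) (raise β j) γ → Above (j ∷ S) β γ
  Above-unraise (above lo fr) = above
    (λ i → ℕ.≤-trans (lookup-raise-≤ β j i) (lo i))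
    λ i i∉ → ≡.trans
      (fr i λ i∈ → i∉ ([ there , (λ { (here e) → here e }) ]′ (∈-++⁻ S i∈)))
      (lookup-raise-≢ β (i∉ ∘ here))

  Above-freeze : lookup γ j ≡ lookup β j → Above (j ∷ S) β γ → Above S β γ
  Above-freeze γj≡βj (above lo fr) = above lo go
    where
    go : ∀ i → i ∉ S → lookup γ i ≡ lookup β i
    go i i∉ with i Fin.≟ j
    ... | yes ≡.refl = γj≡βj
    ... | no  i≢j    = fr i λ { (here e) → i≢j e ; (there i∈) → i∉ i∈ }

  Above-raise : lookup β j ℕ.< lookup γ j → Above (j ∷ S) β γ → Above (S ++ j ∷ []) (raise β j) γ
  Above-raise βj<γj (above lo fr) = above go λ i i∉ →
    ≡.trans (fr i λ { (here e) → i∉ (∈-++⁺ʳ S (here e)) ; (there i∈) → i∉ (∈-++⁺ˡ i∈) })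
            (≡.sym (lookup-raise-≢ β λ e → i∉ (∈-++⁺ʳ S (here e))))
    where
    go : ∀ i → lookup (raise β j) i ℕ.≤ lookup γ i
    go i with i Fin.≟ j
    ... | yes ≡.refl = ≡.subst (ℕ._≤ lookup γ i) (≡.sym (lookup∘updateAt i β)) βj<γj
    ... | no  i≢j    = ≡.subst (ℕ._≤ lookup γ i) (≡.sym (lookup-raise-≢ β i≢j)) (lo i)

-- Polynomials over a commutative ring and Newton interpolation

module Polynomials {c ℓ} (R : CommutativeRing c ℓ) where
  open CommutativeRing R hiding (zero) renaming (Carrier to C)
  open SemiringSolver commutativeSemiring using (solve; _:=_; _:+_; _:*_)
  open SetoidReasoning setoid
  open RingProperties ring using (-‿distribˡ-*; -1*x≈-x; -‿involutive; x∙y⁻¹≈ε⇒x≈y)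

  Unit : C → Set _
  Unit a = ∃ λ b → a * b ≈ 1#

  Unit-resp : ∀ {a b} → a ≈ b → Unit a → Unit b
  Unit-resp a≈b (i , ai≈1) = i , trans (*-congʳ (sym a≈b)) ai≈1

  Unit-* : ∀ {a b} → Unit a → Unit b → Unit (a * b)
  Unit-* {a} {b} (i , ai≈1) (j , bj≈1) = i * j , (begin
    (a * b) * (i * j)  ≈⟨ solve 4 (λ a b i j → (a :* b) :* (i :* j) := (a :* i) :* (b :* j)) refl a b i j ⟩
    (a * i) * (b * j)  ≈⟨ *-cong ai≈1 bj≈1 ⟩
    1# * 1#            ≈⟨ *-identityˡ 1# ⟩
    1#                 ∎)

  Unit-cancel : ∀ {a b} → Unit a → b * a ≈ 0# → b ≈ 0#
  Unit-cancel {a} {b} (i , ai≈1) ba≈0 = begin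
    b            ≈⟨ *-identityʳ b ⟨
    b * 1#       ≈⟨ *-congˡ ai≈1 ⟨
    b * (a * i)  ≈⟨ *-assoc b a i ⟨
    (b * a) * i  ≈⟨ *-congʳ ba≈0 ⟩
    0# * i       ≈⟨ zeroˡ i ⟩
    0#           ∎

  -- Finite sums and their decomposition into fibres.

  pick skip : ∀ {p} {P : Set p} → Dec P → C → C
  pick (yes _) x = x
  pick (no  _) x = 0#
  skip (yes _) x = 0#
  skip (no  _) x = x

  pick-yes : ∀ {p} {P : Set p} (P? : Dec P) {x} → P → pick P? x ≈ x
  pick-yes (yes _) p = refl
  pick-yes (no ¬p) p = contradiction p ¬p

  pick-no : ∀ {p} {P : Set p} (P? : Dec P) {x} → ¬ P → pick P? x ≈ 0#
  pick-no (yes p) ¬p = contradiction p ¬p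
  pick-no (no _)  ¬p = refl

  skip-no : ∀ {p} {P : Set p} (P? : Dec P) {x} → ¬ P → skip P? x ≈ x
  skip-no (yes p) ¬p = contradiction p ¬p
  skip-no (no _)  ¬p = refl

  pick-zero : ∀ {p} {P : Set p} (P? : Dec P) {x} → (P → x ≈ 0#) → pick P? x ≈ 0#
  pick-zero (yes p) x≈0 = x≈0 p
  pick-zero (no _)  x≈0 = refl

  pick-*ʳ : ∀ {p} {P : Set p} (P? : Dec P) x y → pick P? x * y ≈ pick P? (x * y)
  pick-*ʳ (yes _) x y = refl
  pick-*ʳ (no _)  x y = zeroˡ y

  pick-*ˡ : ∀ {p} {P : Set p} (P? : Dec P) x y → x * pick P? y ≈ pick P? (x * y)
  pick-*ˡ (yes _) x y = refl
  pick-*ˡ (no _)  x y = zeroʳ x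

  pick+skip : ∀ {p} {P : Set p} (P? : Dec P) x → x ≈ pick P? x + skip P? x
  pick+skip (yes _) x = sym (+-identityʳ x)
  pick+skip (no _)  x = sym (+-identityˡ x)

  pick-cong : ∀ {p} {P : Set p} (P? : Dec P) {x y} → (P → x ≈ y) → pick P? x ≈ pick P? y
  pick-cong (yes p) x≈y = x≈y p
  pick-cong (no _)  x≈y = refl

  sumOn : ∀ {a} {A : Set a} → (A → C) → List A → C
  sumOn f []       = 0#
  sumOn f (x ∷ xs) = f x + sumOn f xs

  module _ {a} {A : Set a} where

    sumOn-cong : ∀ {f g : A → C} → (∀ x → f x ≈ g x) → ∀ xs → sumOn f xs ≈ sumOn g xs
    sumOn-cong f≈g []       = refl
    sumOn-cong f≈g (x ∷ xs) = +-cong (f≈g x) (sumOn-cong f≈g xs)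

    sumOn-All-cong : ∀ {f g : A → C} {xs} → All (λ x → f x ≈ g x) xs → sumOn f xs ≈ sumOn g xs
    sumOn-All-cong []         = refl
    sumOn-All-cong (e ∷ f≈g) = +-cong e (sumOn-All-cong f≈g)

    sumOn-zero : ∀ {f : A → C} {xs} → All (λ x → f x ≈ 0#) xs → sumOn f xs ≈ 0#
    sumOn-zero []         = refl
    sumOn-zero (e ∷ f≈0) = trans (+-cong e (sumOn-zero f≈0)) (+-identityˡ 0#)

    sumOn-+ : ∀ (f g : A → C) xs → sumOn (λ x → f x + g x) xs ≈ sumOn f xs + sumOn g xs
    sumOn-+ f g []       = sym (+-identityˡ 0#)
    sumOn-+ f g (x ∷ xs) = trans (+-congˡ (sumOn-+ f g xs))
      (solve 4 (λ a b c d → (a :+ b) :+ (c :+ d) := (a :+ c) :+ (b :+ d)) refl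
        (f x) (g x) (sumOn f xs) (sumOn g xs))

    sumOn-*ˡ : ∀ y (f : A → C) xs → sumOn (λ x → y * f x) xs ≈ y * sumOn f xs
    sumOn-*ˡ y f []       = sym (zeroʳ y)
    sumOn-*ˡ y f (x ∷ xs) = trans (+-congˡ (sumOn-*ˡ y f xs)) (sym (distribˡ y _ _))

    sumOn-*ʳ : ∀ y (f : A → C) xs → sumOn (λ x → f x * y) xs ≈ sumOn f xs * y
    sumOn-*ʳ y f []       = sym (zeroˡ y)
    sumOn-*ʳ y f (x ∷ xs) = trans (+-congˡ (sumOn-*ʳ y f xs)) (sym (distribʳ y _ _))

    sumOn-++ : ∀ (f : A → C) xs ys → sumOn f (xs ++ ys) ≈ sumOn f xs + sumOn f ys
    sumOn-++ f []       ys = sym (+-identityˡ _)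
    sumOn-++ f (x ∷ xs) ys = trans (+-congˡ (sumOn-++ f xs ys)) (sym (+-assoc _ _ _))

    sumOn-map : ∀ {b} {B : Set b} (f : A → C) (h : B → A) xs →
                sumOn f (map h xs) ≡ sumOn (f ∘ h) xs
    sumOn-map f h []       = ≡.refl
    sumOn-map f h (x ∷ xs) = ≡.cong (f (h x) +_) (sumOn-map f h xs)

    sumOn-filter : ∀ {p} {P : A → Set p} (P? : Decidable P) (f : A → C) xs →
                   sumOn f (filter P? xs) ≈ sumOn (λ x → pick (P? x) (f x)) xs
    sumOn-filter P? f []       = refl
    sumOn-filter P? f (x ∷ xs) with P? x
    ... | yes _ = +-congˡ (sumOn-filter P? f xs)
    ... | no  _ = trans (sumOn-filter P? f xs) (sym (+-identityˡ _))

    module _ {b} {B : Set b} (_≟_ : DecidableEquality B) (key : A → B) where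

      private
        pick-skip-≡ : ∀ k (f : A → C) x → pick (key x ≟ k) (skip (key x ≟ k) (f x)) ≈ 0#
        pick-skip-≡ k f x with key x ≟ k
        ... | yes _ = refl
        ... | no  _ = refl

        pick-skip-≢ : ∀ {k l} → l ≢ k → ∀ (f : A → C) x →
                      pick (key x ≟ l) (skip (key x ≟ k) (f x)) ≈ pick (key x ≟ l) (f x)
        pick-skip-≢ {k} l≢k f x = pick-cong (key x ≟ _) λ { ≡.refl → skip-no (key x ≟ k) l≢k }

        module _ (k : B) (f : A → C) (xs : List A) where

          fibres-skip : (∀ l → l ≢ k → sumOn (λ x → pick (key x ≟ l) (f x)) xs ≈ 0#) →
            ∀ l → sumOn (λ x → pick (key x ≟ l) (skip (key x ≟ k) (f x))) xs ≈ 0#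
          fibres-skip fibres l with l ≟ k
          ... | yes ≡.refl = sumOn-zero (All.universal (pick-skip-≡ k f) xs)
          ... | no  l≢k    = trans (sumOn-cong (pick-skip-≢ l≢k f) xs) (fibres l l≢k)

          split-fibre : sumOn f xs ≈ sumOn (λ x → pick (key x ≟ k) (f x)) xs
                                   + sumOn (λ x → skip (key x ≟ k) (f x)) xs
          split-fibre = trans (sumOn-cong (λ x → pick+skip (key x ≟ k) (f x)) xs) (sumOn-+ _ _ xs)

        -- Induction on a list covering the keys. Terms over the first key are set to zero by `skip`
        -- rather than deleted, so `xs` stays fixed, the other fibres keep their sums, and
        -- repetitions in `ks` do no harm.
        sumOn-keys : ∀ ks (f : A → C) xs → All (λ x → key x ∈ ks ⊎ f x ≈ 0#) xs →
                     (∀ k → sumOn (λ x → pick (key x ≟ k) (f x)) xs ≈ 0#) → sumOn f xs ≈ 0#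
        sumOn-keys []       f xs supp fibres = sumOn-zero (All.map [ (λ ()) , id ]′ supp)
        sumOn-keys (k ∷ ks) f xs supp fibres =
          trans (split-fibre k f xs)
          (trans (+-cong (fibres k) (sumOn-keys ks _ xs (All.map supp′ supp)
                   (fibres-skip k f xs λ l _ → fibres l)))
                 (+-identityˡ 0#))
          where
          supp′ : ∀ {x} → key x ∈ (k ∷ ks) ⊎ f x ≈ 0# → key x ∈ ks ⊎ skip (key x ≟ k) (f x) ≈ 0#
          supp′ {x} s with key x ≟ k
          supp′ {x} s                | yes _ = inj₂ refl
          supp′ {x} (inj₁ (here e))  | no ≢k = contradiction e ≢k
          supp′ {x} (inj₁ (there i)) | no _  = inj₁ i
          supp′ {x} (inj₂ e)         | no _  = inj₂ e

      sumOn-fibres : ∀ (f : A → C) xs →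
        (∀ k → sumOn (λ x → pick (key x ≟ k) (f x)) xs ≈ 0#) → sumOn f xs ≈ 0#
      sumOn-fibres f xs = sumOn-keys (map key xs) f xs (All.tabulate (inj₁ ∘ ∈-map⁺ key))

      sumOn-fibre : ∀ k (f : A → C) xs →
        (∀ l → l ≢ k → sumOn (λ x → pick (key x ≟ l) (f x)) xs ≈ 0#) →
        sumOn f xs ≈ sumOn (λ x → pick (key x ≟ k) (f x)) xs
      sumOn-fibre k f xs fibres = trans (split-fibre k f xs)
        (trans (+-congˡ (sumOn-fibres _ xs (fibres-skip k f xs fibres))) (+-identityʳ _))

  -- Polynomials as formal sums, seen through linear functionals.

  module _ {n : ℕ} where

    infix 4 _≟_
    _≟_ : DecidableEquality (Comp n)
    _≟_ = ≡-dec ℕ._≟_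

    Poly : Set c
    Poly = List (C × Comp n)

    -- A polynomial is only ever inspected through linear functionals, given by
    -- their values L m on monomials: coefficients and evaluations are instances.
    lin : (Comp n → C) → Poly → C
    lin L = sumOn (λ (a , m) → a * L m)

    infix 4 _≐_
    _≐_ : Poly → Poly → Set _
    p ≐ q = ∀ L → lin L p ≈ lin L q

    δ : Comp n → Comp n → C
    δ m m′ = pick (m′ ≟ m) 1#

    coeff : Poly → Comp n → C
    coeff p m = lin (δ m) p

    mono : Comp n → Poly
    mono m = (1# , m) ∷ []

    scale : C → Poly → Poly
    scale a = map (λ (b , m) → (a * b , m))

    lin-cong : ∀ {L L′} → (∀ m → L m ≈ L′ m) → ∀ p → lin L p ≈ lin L′ p
    lin-cong L≈L′ = sumOn-cong λ (a , m) → *-congˡ (L≈L′ m)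

    lin-*ˡ : ∀ a L p → lin (λ m → a * L m) p ≈ a * lin L p
    lin-*ˡ a L p = trans
      (sumOn-cong (λ (b , m) → solve 3 (λ a b l → b :* (a :* l) := a :* (b :* l)) refl a b (L m)) p)
      (sumOn-*ˡ a _ p)

    lin-scale : ∀ L a p → lin L (scale a p) ≈ a * lin L p
    lin-scale L a p = trans (reflexive (sumOn-map _ _ p))
      (trans (sumOn-cong (λ (b , m) → *-assoc a b (L m)) p) (sumOn-*ˡ a _ p))

    lin-++ : ∀ L p q → lin L (p ++ q) ≈ lin L p + lin L q
    lin-++ L = sumOn-++ _

    lin-mono : ∀ L m → lin L (mono m) ≈ L m
    lin-mono L m = trans (+-identityʳ _) (*-identityˡ _)

    lin-filter : ∀ {P : Comp n → Set} (P? : Decidable P) L p →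
      lin L (filter (P? ∘ proj₂) p) ≈ lin (λ m → pick (P? m) (L m)) p
    lin-filter P? L p = trans (sumOn-filter (P? ∘ proj₂) _ p)
      (sumOn-cong (λ (a , m) → sym (pick-*ˡ (P? m) a (L m))) p)

    -- A list may repeat a monomial, so the terms are first collected: the fibre over `k`
    -- contributes `coeff p k * L k`.
    lin-zero : ∀ L p → (∀ m → coeff p m * L m ≈ 0#) → lin L p ≈ 0#
    lin-zero L p h = sumOn-fibres _≟_ proj₂ _ p λ k → begin
      sumOn (λ (a , m) → pick (m ≟ k) (a * L m)) p
        ≈⟨ sumOn-cong (λ (a , m) → trans
             (pick-cong (m ≟ k) λ { ≡.refl → *-congʳ (sym (*-identityʳ a)) })
             (trans (sym (pick-*ʳ (m ≟ k) (a * 1#) (L k))) (*-congʳ (sym (pick-*ˡ (m ≟ k) a 1#))))) p ⟩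
      sumOn (λ (a , m) → (a * δ k m) * L k) p
        ≈⟨ sumOn-*ʳ (L k) _ p ⟩
      coeff p k * L k
        ≈⟨ h k ⟩
      0# ∎

    -- Makes evaluation well defined on polynomials known only by their coefficients: `lin-zero`
    -- applies to the difference.
    coeff-ext : ∀ p q → (∀ m → coeff p m ≈ coeff q m) → p ≐ q
    coeff-ext p q p≈q L = x∙y⁻¹≈ε⇒x≈y _ _ (begin
      lin L p - lin L q                    ≈⟨ +-congˡ (-lin L) ⟨
      lin L p + lin L (scale (- 1#) q)     ≈⟨ lin-++ L p _ ⟨
      lin L (p ++ scale (- 1#) q)          ≈⟨ lin-zero L (p ++ scale (- 1#) q) (λ m →
                                                trans (*-congʳ (zeros m)) (zeroˡ _)) ⟩
      0# ∎)
      where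
      -lin : ∀ L → lin L (scale (- 1#) q) ≈ - lin L q
      -lin L = trans (lin-scale L (- 1#) q) (-1*x≈-x _)
      zeros : ∀ m → coeff (p ++ scale (- 1#) q) m ≈ 0#
      zeros m = trans (lin-++ (δ m) p _)
        (trans (+-cong (p≈q m) (-lin (δ m))) (-‿inverseʳ _))

    lin-pick-δ : ∀ {P : Comp n → Set} (P? : Decidable P) m p →
      lin (λ m′ → pick (P? m′) (δ m m′)) p ≈ pick (P? m) (coeff p m)
    lin-pick-δ P? m p = trans (lin-cong pointwise p) (last (P? m))
      where
      pointwise : ∀ m′ → pick (P? m′) (δ m m′) ≈ pick (P? m) (δ m m′)
      pointwise m′ with m′ ≟ m
      ... | yes ≡.refl = refl
      ... | no  _      = trans (pick-zero (P? m′) (λ _ → refl)) (sym (pick-zero (P? m) (λ _ → refl)))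
      last : ∀ {Q : Set} (Q? : Dec Q) → lin (λ m′ → pick Q? (δ m m′)) p ≈ pick Q? (coeff p m)
      last (yes _) = refl
      last (no _)  = sumOn-zero (All.universal (λ (a , _) → zeroʳ a) p)

    DegreeBelow : ℕ → Poly → Set _
    DegreeBelow d p = All (λ t → ∣ proj₂ t ∣ ℕ.< d) p

    coeff-DegreeBelow : ∀ {d p} m → DegreeBelow d p → d ℕ.≤ ∣ m ∣ → coeff p m ≈ 0#
    coeff-DegreeBelow m low d≤ = sumOn-zero (All.map
      (λ {(a , m′)} m′<d → trans
         (*-congˡ (pick-no (m′ ≟ m) λ { ≡.refl → ℕ.<⇒≱ m′<d d≤ })) (zeroʳ a)) low)

    truncate : ℕ → Poly → Poly
    truncate d = filter (λ t → ∣ proj₂ t ∣ ℕ.<? d)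

    -- Vanishing high coefficients do not keep high monomials out of the list, since their terms may
    -- cancel. They must be removed before a bound on every listed monomial is available for
    -- induction.
    truncate-≐ : ∀ d p → (∀ m → d ℕ.≤ ∣ m ∣ → coeff p m ≈ 0#) → p ≐ truncate d p
    truncate-≐ d p high≈0 L = begin
      lin L p
        ≈⟨ sumOn-cong (λ (a , m) → trans (*-congˡ (pick+skip (∣ m ∣ ℕ.<? d) (L m))) (distribˡ a _ _)) p ⟩
      sumOn (λ (a , m) → a * pick (∣ m ∣ ℕ.<? d) (L m) + a * skip (∣ m ∣ ℕ.<? d) (L m)) p
        ≈⟨ sumOn-+ _ _ p ⟩
      lin (λ m → pick (∣ m ∣ ℕ.<? d) (L m)) p + lin (λ m → skip (∣ m ∣ ℕ.<? d) (L m)) p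
        ≈⟨ +-cong (sym (lin-filter (λ m → ∣ m ∣ ℕ.<? d) L p)) (lin-zero _ p high) ⟩
      lin L (truncate d p) + 0#
        ≈⟨ +-identityʳ _ ⟩
      lin L (truncate d p) ∎
      where
      high : ∀ m → coeff p m * skip (∣ m ∣ ℕ.<? d) (L m) ≈ 0#
      high m with ∣ m ∣ ℕ.<? d
      ... | yes _ = zeroʳ _
      ... | no m≮d = trans (*-congʳ (high≈0 m (ℕ.≮⇒≥ m≮d))) (zeroˡ _)

  -- Values of monomials, and the sign of the reflection x ↦ -x.

  infixr 8 _^_
  _^_ : C → ℕ → C
  x ^ zero  = 1#
  x ^ suc k = x * x ^ k

  mon : ∀ {n} → Vec C n → Comp n → C
  mon []      []      = 1#
  mon (x ∷ v) (k ∷ m) = x ^ k * mon v m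

  mon-updateAt : ∀ {n} (v : Vec C n) m j → mon v (updateAt m j suc) ≈ lookup v j * mon v m
  mon-updateAt (x ∷ v) (k ∷ m) Fin.zero    = *-assoc x (x ^ k) (mon v m)
  mon-updateAt (x ∷ v) (k ∷ m) (Fin.suc j) = trans (*-congˡ (mon-updateAt v m j))
    (solve 3 (λ a b c → a :* (b :* c) := b :* (a :* c)) refl (x ^ k) (lookup v j) (mon v m))

  mon-zero : ∀ {n} (v : Vec C n) → mon v (V.replicate n 0) ≈ 1#
  mon-zero []      = refl
  mon-zero (x ∷ v) = trans (*-identityˡ _) (mon-zero v)

  sgn : ℕ → C
  sgn k = (- 1#) ^ k

  sgn-+ : ∀ k l → sgn (k ℕ.+ l) ≈ sgn k * sgn l
  sgn-+ zero    l = sym (*-identityˡ _)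
  sgn-+ (suc k) l = trans (*-congˡ (sgn-+ k l)) (sym (*-assoc _ _ _))

  sgn-square : ∀ k → sgn k * sgn k ≈ 1#
  sgn-square zero    = *-identityˡ 1#
  sgn-square (suc k) = begin
    (- 1# * sgn k) * (- 1# * sgn k)  ≈⟨ solve 2 (λ a b → (a :* b) :* (a :* b) := (a :* a) :* (b :* b)) refl (- 1#) (sgn k) ⟩
    (- 1# * - 1#) * (sgn k * sgn k)  ≈⟨ *-cong (trans (-1*x≈-x (- 1#)) (-‿involutive 1#)) (sgn-square k) ⟩
    1# * 1#                          ≈⟨ *-identityˡ 1# ⟩
    1#                               ∎

  neg-^ : ∀ x k → (- x) ^ k ≈ sgn k * x ^ k
  neg-^ x zero    = sym (*-identityˡ 1#)
  neg-^ x (suc k) = trans (*-cong (sym (-1*x≈-x x)) (neg-^ x k))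
    (solve 4 (λ s x a b → (s :* x) :* (a :* b) := (s :* a) :* (x :* b)) refl (- 1#) x (sgn k) (x ^ k))

  mon-neg : ∀ {n} (v : Vec C n) m → mon (V.map -_ v) m ≈ sgn ∣ m ∣ * mon v m
  mon-neg []      []      = sym (*-identityˡ 1#)
  mon-neg (x ∷ v) (k ∷ m) = begin
    (- x) ^ k * mon (V.map -_ v) m
      ≈⟨ *-cong (neg-^ x k) (mon-neg v m) ⟩
    (sgn k * x ^ k) * (sgn ∣ m ∣ * mon v m)
      ≈⟨ solve 4 (λ a b c d → (a :* b) :* (c :* d) := (a :* c) :* (b :* d)) refl
           (sgn k) (x ^ k) (sgn ∣ m ∣) (mon v m) ⟩
    (sgn k * sgn ∣ m ∣) * (x ^ k * mon v m)
      ≈⟨ *-congʳ (sgn-+ k ∣ m ∣) ⟨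
    sgn (k ℕ.+ ∣ m ∣) * (x ^ k * mon v m) ∎

  -- What interpolation needs to know about the points `x γ`. `Adm S β` describes a state of the
  -- traversal: `β` has been reached, `S` lists the free coordinates, and its head is visited next.
  -- `flat` makes the factor of a raise vanish where `j` was frozen; `steep` makes it invertible
  -- where `j` was raised.
  record Nodes {n} (x : Comp n → Vec C n) (Adm : List (Fin n) → Comp n → Set) : Set (c ⊔ ℓ) where
    field
      freeze : ∀ {j S β} → Adm (j ∷ S) β → Adm S β
      raised : ∀ {j S β} → Adm (j ∷ S) β → Adm (S ++ j ∷ []) (raise β j)
      fresh  : ∀ {j S β} → Adm (j ∷ S) β → j ∉ S
      flat   : ∀ {j S β γ} → Adm (j ∷ S) β → Above (j ∷ S) β γ →
               lookup γ j ≡ lookup β j → lookup (x γ) j ≈ lookup (x β) j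
      steep  : ∀ {j S β γ} → Adm (j ∷ S) β → Above (j ∷ S) β γ →
               lookup β j ℕ.< lookup γ j → Unit (lookup (x γ) j - lookup (x β) j)

  -- The Newton basis and its triangularity.

  module Newton {n : ℕ} {x : Comp n → Vec C n} {Adm : List (Fin n) → Comp n → Set} (nodes : Nodes x Adm) where
    open Nodes nodes

    ev : Comp n → Poly → C
    ev γ = lin (mon (x γ))

    -- A pair `(β , ρ)` stands for x^β + ρ. With the leading term kept apart, monicity is built in
    -- and only the degree of `ρ` has to be tracked.
    Node : Set c
    Node = Comp n × Poly {n}

    newton : Node → Poly
    newton (β , ρ) = (1# , β) ∷ ρ

    shift : Fin n → Poly → Poly
    shift j = map (λ (a , m) → (a , raise m j))

    step : Fin n → Node → Node
    step j (β , ρ) = raise β j , (shift j ρ ++ scale (- lookup (x β) j) (newton (β , ρ)))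

    -- The number is a budget of raises plus one: raising consumes a unit, freezing none. All nodes
    -- that freeze `j` are listed before those that raise it, and this order is what makes the
    -- evaluation matrix triangular.
    enum : ℕ → List (Fin n) → Node → List Node
    enum zero    S       b = []
    enum (suc d) []      b = b ∷ []
    enum (suc d) (j ∷ S) b = enum (suc d) S b ++ enum d (S ++ j ∷ []) (step j b)

    newton-step : ∀ v j b →
      lin (mon v) (newton (step j b)) ≈ (lookup v j - lookup (x (proj₁ b)) j) * lin (mon v) (newton b)
    newton-step v j b@(β , ρ) = begin
      -- This list is `newton (step j b)` by computation: shifting `newton b` puts the new leading
      -- term in front.
      lin (mon v) (shift j (newton b) ++ scale (- a) (newton b))
        ≈⟨ lin-++ (mon v) (shift j (newton b)) (scale (- a) (newton b)) ⟩
      lin (mon v) (shift j (newton b)) + lin (mon v) (scale (- a) (newton b))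
        ≈⟨ +-cong (trans (reflexive (sumOn-map _ _ (newton b)))
             (trans (lin-cong (λ m → mon-updateAt v m j) (newton b)) (lin-*ˡ (lookup v j) (mon v) (newton b))))
             (lin-scale (mon v) (- a) (newton b)) ⟩
      lookup v j * lin (mon v) (newton b) + (- a) * lin (mon v) (newton b)
        ≈⟨ distribʳ _ _ _ ⟨
      (lookup v j - a) * lin (mon v) (newton b) ∎
      where a = lookup (x β) j

    Low : Node → Set c
    Low (β , ρ) = DegreeBelow ∣ β ∣ ρ

    step-Low : ∀ j b → Low b → Low (step j b)
    step-Low j b@(β , ρ) low = All.++⁺
      (All.map⁺ (All.map (λ {(_ , m)} m<β →
        ≡.subst₂ ℕ._<_ (≡.sym (∣raise∣ m j)) (≡.sym (∣raise∣ β j)) (ℕ.s≤s m<β)) low))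
      (All.map⁺ (≡.subst (∣ β ∣ ℕ.<_) (≡.sym (∣raise∣ β j)) ℕ.≤-refl
        ∷ All.map (λ m<β → ≡.subst (_ ℕ.<_) (≡.sym (∣raise∣ β j)) (ℕ.m<n⇒m<1+n m<β)) low))

    enum-Low : ∀ d S b → Low b → All Low (enum d S b)
    enum-Low zero    S       b low = []
    enum-Low (suc d) []      b low = low ∷ []
    enum-Low (suc d) (j ∷ S) b low =
      All.++⁺ (enum-Low (suc d) S b low) (enum-Low d _ _ (step-Low j b low))

    enum-size : ∀ d S b → All (λ b′ → ∣ proj₁ b′ ∣ ℕ.< d ℕ.+ ∣ proj₁ b ∣) (enum d S b)
    enum-size zero    S       b = []
    enum-size (suc d) []      b = ℕ.s≤s (ℕ.m≤n+m _ d) ∷ []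
    enum-size (suc d) (j ∷ S) b = All.++⁺ (enum-size (suc d) S b)
      (All.map (λ {b′} → ≡.subst (∣ proj₁ b′ ∣ ℕ.<_)
        (≡.trans (≡.cong (d ℕ.+_) (∣raise∣ (proj₁ b) j)) (ℕ.+-suc d _))) (enum-size d _ (step j b)))

    enum-Above : ∀ d S b → All (λ b′ → Above S (proj₁ b) (proj₁ b′)) (enum d S b)
    enum-Above zero    S       b = []
    enum-Above (suc d) []      b = above (λ _ → ℕ.≤-refl) (λ _ _ → ≡.refl) ∷ []
    enum-Above (suc d) (j ∷ S) b = All.++⁺
      (All.map Above-unfreeze (enum-Above (suc d) S b))
      (All.map Above-unraise (enum-Above d _ (step j b)))

    -- Each step multiplies by a linear factor, so a zero of `newton b` is inherited by every node
    -- reached from `b`.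
    enum-vanish : ∀ v d S b → lin (mon v) (newton b) ≈ 0# →
                  All (λ b′ → lin (mon v) (newton b′) ≈ 0#) (enum d S b)
    enum-vanish v zero    S       b z = []
    enum-vanish v (suc d) []      b z = z ∷ []
    enum-vanish v (suc d) (j ∷ S) b z = All.++⁺ (enum-vanish v (suc d) S b z)
      (enum-vanish v d _ (step j b) (trans (newton-step v j b) (trans (*-congˡ z) (zeroʳ _))))

    enum-complete : ∀ d S b {γ} → Above S (proj₁ b) γ → ∣ γ ∣ ℕ.< d ℕ.+ ∣ proj₁ b ∣ →
                    Any (λ b′ → proj₁ b′ ≡ γ) (enum d S b)
    enum-complete zero    S       b {γ} γ≥ γ< = contradiction (∣∣-mono (proj₁ b) γ (lower γ≥)) (ℕ.<⇒≱ γ<)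
    enum-complete (suc d) []      b γ≥ γ< = here (lookup-ext λ i → ≡.sym (frozen γ≥ i λ ()))
    enum-complete (suc d) (j ∷ S) b {γ} γ≥ γ< =
      [ (λ βj<γj → Any.++⁺ʳ (enum (suc d) S b)
          (enum-complete d _ (step j b) (Above-raise βj<γj γ≥)
            (≡.subst (∣ γ ∣ ℕ.<_)
              (≡.sym (≡.trans (≡.cong (d ℕ.+_) (∣raise∣ (proj₁ b) j)) (ℕ.+-suc d _))) γ<)))
      , (λ βj≡γj → Any.++⁺ˡ (enum-complete (suc d) S b (Above-freeze (≡.sym βj≡γj) γ≥) γ<))
      ]′ (ℕ.m≤n⇒m<n∨m≡n (lower γ≥ j))

    raised-> : ∀ {S : List (Fin n)} {β γ : Comp n} {j} → Above S (raise β j) γ → lookup β j ℕ.< lookup γ j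
    raised-> {β = β} {j = j} γ≥ = ≡.subst (ℕ._≤ _) (lookup∘updateAt j β) (lower γ≥ j)

    -- The hypothesis speaks of every `γ` above the current node, because the composition at which
    -- the path will end is not yet known.
    enum-Unit : ∀ d S b → Adm S (proj₁ b) →
      (∀ {γ} → Above S (proj₁ b) γ → Unit (ev γ (newton b))) →
      All (λ b′ → Unit (ev (proj₁ b′) (newton b′))) (enum d S b)
    enum-Unit zero    S       b adm u = []
    enum-Unit (suc d) []      b adm u = u (above (λ _ → ℕ.≤-refl) (λ _ _ → ≡.refl)) ∷ []
    enum-Unit (suc d) (j ∷ S) b adm u = All.++⁺
      (enum-Unit (suc d) S b (freeze adm) (u ∘ Above-unfreeze))
      (enum-Unit d _ (step j b) (raised adm) λ {γ} γ≥ →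
        Unit-resp (sym (newton-step (x γ) j b))
          (Unit-* (steep adm (Above-unraise γ≥) (raised-> γ≥)) (u (Above-unraise γ≥))))

    Precedes : Node → Node → Set _
    Precedes (γ , _) b′ = γ ≢ proj₁ b′ × ev γ (newton b′) ≈ 0#

    -- Only pairs from different branches need an argument, given in `cross`: where `j` was frozen,
    -- the factor common to the whole raising branch is zero by `flat`.
    enum-Precedes : ∀ d S b → Adm S (proj₁ b) → AllPairs Precedes (enum d S b)
    enum-Precedes zero    S       b adm = []
    enum-Precedes (suc d) []      b adm = [] ∷ []
    enum-Precedes (suc d) (j ∷ S) b@(β , _) adm = AllPairs.++⁺
      (enum-Precedes (suc d) S b (freeze adm))
      (enum-Precedes d _ (step j b) (raised adm))
      (All.map (λ {b′} → cross {b′}) (enum-Above (suc d) S b))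
      where
      cross : ∀ {b′} → Above S β (proj₁ b′) → All (Precedes b′) (enum d (S ++ j ∷ []) (step j b))
      cross {γ , _} γ≥ = All.zipWith id
        ( All.map (λ {b″} γ′≥ γ≡ → ℕ.<⇒≢ (raised-> γ′≥)
            (≡.trans (≡.sym γj≡βj) (≡.cong (λ γ → lookup γ j) γ≡))) (enum-Above d _ (step j b))
        , enum-vanish (x γ) d _ (step j b) (trans (newton-step (x γ) j b)
            (trans (*-congʳ (trans (+-congʳ (flat adm (Above-unfreeze γ≥) γj≡βj)) (-‿inverseʳ _)))
                   (zeroˡ _))))
        where
        γj≡βj : lookup γ j ≡ lookup β j
        γj≡βj = frozen γ≥ j (fresh adm)

    newton-coeff : ∀ {b} m → Low b → ∣ proj₁ b ∣ ℕ.≤ ∣ m ∣ → coeff (newton b) m ≈ δ m (proj₁ b)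
    newton-coeff m low β≤m =
      trans (+-cong (*-identityˡ _) (coeff-DegreeBelow m low β≤m)) (+-identityʳ _)

    newton-coeff-≢ : ∀ {b} m → Low b → ∣ proj₁ b ∣ ℕ.≤ ∣ m ∣ → proj₁ b ≢ m → coeff (newton b) m ≈ 0#
    newton-coeff-≢ {b} m low β≤m β≢m = trans (newton-coeff {b} m low β≤m) (pick-no (proj₁ b ≟ m) β≢m)

    -- The span described by duality. Evaluations and coefficients are both functionals, so one
    -- statement yields vanishing at nodes as well as degree bounds.
    Span : List Node → Poly → Set _
    Span B f = ∀ L → All (λ b → lin L (newton b) ≈ 0#) B → lin L f ≈ 0#

    Own : Node → Set _
    Own b = Unit (ev (proj₁ b) (newton b))

    -- Forward substitution: the later Newton polynomials vanish at the first node, so the value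
    -- there fixes the first coefficient, and the remaining nodes interpolate what is left of `t`.
    interpolate : ∀ B → AllPairs Precedes B → All Own B → (t : Comp n → C) →
      ∃ λ f → All (λ b → ev (proj₁ b) f ≈ t (proj₁ b)) B × Span B f
    interpolate []      []         []                t = [] , [] , λ _ _ → refl
    interpolate (b@(γ , _) ∷ B) (pb ∷ pB) ((i , bi≈1) ∷ uB) t
      with f , f≈t , f∈B ← interpolate B pB uB
             (λ γ′ → t γ′ - (t γ * i) * ev γ′ (newton b))
      = scale a (newton b) ++ f , head ∷ All.map (λ {b} → tail {b}) f≈t , span
      where
      a : C
      a = t γ * i
      head : ev γ (scale a (newton b) ++ f) ≈ t γ
      head = begin
        ev γ (scale a (newton b) ++ f)
          ≈⟨ trans (lin-++ _ (scale a (newton b)) f) (+-cong (lin-scale _ a (newton b)) (f∈B _ (All.map proj₂ pb))) ⟩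
        (t γ * i) * ev γ (newton b) + 0#
          ≈⟨ +-identityʳ _ ⟩
        (t γ * i) * ev γ (newton b)
          ≈⟨ solve 3 (λ t i e → (t :* i) :* e := t :* (e :* i)) refl (t γ) i _ ⟩
        t γ * (ev γ (newton b) * i)
          ≈⟨ *-congˡ bi≈1 ⟩
        t γ * 1#
          ≈⟨ *-identityʳ _ ⟩
        t γ ∎
      tail : ∀ {b′} → ev (proj₁ b′) f ≈ t (proj₁ b′) - a * ev (proj₁ b′) (newton b) →
             ev (proj₁ b′) (scale a (newton b) ++ f) ≈ t (proj₁ b′)
      tail {γ′ , _} e = begin
        ev γ′ (scale a (newton b) ++ f)
          ≈⟨ trans (lin-++ _ (scale a (newton b)) f) (+-cong (lin-scale _ a (newton b)) e) ⟩
        y + (t γ′ - y)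
          ≈⟨ solve 3 (λ y t z → y :+ (t :+ z) := t :+ (y :+ z)) refl y (t γ′) (- y) ⟩
        t γ′ + (y - y)
          ≈⟨ trans (+-congˡ (-‿inverseʳ y)) (+-identityʳ _) ⟩
        t γ′ ∎
        where y = a * ev γ′ (newton b)
      span : Span (b ∷ B) (scale a (newton b) ++ f)
      span L (z ∷ zs) = trans (lin-++ L (scale a (newton b)) f)
        (trans (+-cong (trans (lin-scale L a (newton b)) (trans (*-congˡ z) (zeroʳ a))) (f∈B L zs))
               (+-identityˡ 0#))

    -- The Newton polynomial of `γ` vanishes at the earlier nodes already; a combination of later
    -- ones corrects it at the later nodes. These vanish at `γ`, and as no node is larger than `γ`
    -- they do not contain x^γ, so the value at `γ` and the leading coefficient survive.
    lagrange : ∀ B γ → AllPairs Precedes B → All Own B → All Low B →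
      All (λ b → ∣ proj₁ b ∣ ℕ.≤ ∣ γ ∣) B → Any (λ b → proj₁ b ≡ γ) B →
      ∃ λ f → All (λ b → proj₁ b ≢ γ → ev (proj₁ b) f ≈ 0#) B
            × Unit (ev γ f) × Span B f × coeff f γ ≈ 1#
    lagrange (b@(γ , _) ∷ B) .γ (pb ∷ pB) (ub ∷ uB) (lowb ∷ lowB) (_ ∷ γ≥) (here ≡.refl)
      with g , g≈-b , g∈B ← interpolate B pB uB (λ γ′ → - ev γ′ (newton b))
      = newton b ++ g
      , (contradiction ≡.refl
        ∷ All.map (λ e _ → trans (lin-++ _ (newton b) g) (trans (+-congˡ e) (-‿inverseʳ _))) g≈-b)
      , Unit-resp (sym (trans (lin-++ _ (newton b) g)
          (trans (+-congˡ (g∈B _ (All.map proj₂ pb))) (+-identityʳ _)))) ub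
      , (λ { L (z ∷ zs) → trans (lin-++ L (newton b) g)
          (trans (+-cong z (g∈B L zs)) (+-identityˡ 0#)) })
      , trans (lin-++ (δ γ) (newton b) g) (trans
          (+-cong (trans (newton-coeff {b} γ lowb ℕ.≤-refl) (pick-yes (γ ≟ γ) ≡.refl))
             (g∈B (δ γ) (All.zipWith (λ {b′} ((low , ≤γ) , (γ≢ , _)) →
               newton-coeff-≢ {b′} γ low ≤γ (γ≢ ∘ ≡.sym)) (All.zip (lowB , γ≥) , pb))))
          (+-identityʳ 1#))
    lagrange (b ∷ B) γ (pb ∷ pB) (ub ∷ uB) (lowb ∷ lowB) (_ ∷ γ≥) (there γ∈B)
      with f , fz , fu , f∈B , f1 ← lagrange B γ pB uB lowB γ≥ γ∈B
      = f , ((λ _ → f∈B _ (All.map proj₂ pb)) ∷ fz) , fu , (λ { L (_ ∷ zs) → f∈B L zs }) , f1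

    -- Linear combinations with coefficients that can be read off, as uniqueness requires. A node
    -- may occur repeatedly; `Combination-∷` merges the occurrences of the first one.
    data Combination (B : List Node) (f : Poly) : Set (c ⊔ ℓ) where
      none : f ≐ [] → Combination B f
      plus : ∀ a {b p} → b ∈ B → Combination B p →
             (∀ L → lin L f ≈ a * lin L (newton b) + lin L p) → Combination B f

    Combination-++ : ∀ {B p q} → Combination B p → Combination B q → Combination B (p ++ q)
    Combination-++ {p = p} {q} (none p≐[]) (none q≐[]) =
      none λ L → trans (lin-++ L p q) (trans (+-cong (p≐[] L) (q≐[] L)) (+-identityˡ 0#))
    Combination-++ {p = p} {q} (none p≐[]) (plus a b∈B s e) =
      plus a b∈B s λ L → trans (lin-++ L p q)
        (trans (+-congʳ (p≐[] L)) (trans (+-identityˡ _) (e L)))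
    Combination-++ {p = p} {q} (plus a {p = p′} b∈B s e) t =
      plus a b∈B (Combination-++ s t) λ L → trans (lin-++ L p q)
        (trans (+-congʳ (e L)) (trans (+-assoc _ _ _) (+-congˡ (sym (lin-++ L p′ q)))))

    Combination-∷ : ∀ {b B f} → Combination (b ∷ B) f →
      ∃ λ a → ∃ λ p → Combination B p × (∀ L → lin L f ≈ a * lin L (newton b) + lin L p)
    Combination-∷ (none f≐[]) = 0# , [] , none (λ _ → refl) , λ L →
      trans (f≐[] L) (sym (trans (+-identityʳ _) (zeroˡ _)))
    Combination-∷ {b} (plus a i s e) with Combination-∷ s
    Combination-∷ {b} (plus a (here ≡.refl) s e) | a′ , p , t , e′ =
      a + a′ , p , t , λ L → trans (e L) (trans (+-congˡ (e′ L))
        (solve 4 (λ a a′ x y → a :* x :+ (a′ :* x :+ y) := (a :+ a′) :* x :+ y) refl a a′ _ _))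
    Combination-∷ {b} (plus a {b′} (there i) s e) | a′ , p , t , e′ =
      a′ , (scale a (newton b′) ++ p)
      , plus a i t (λ L → trans (lin-++ L (scale a (newton b′)) p) (+-congʳ (lin-scale L a (newton b′))))
      , λ L → trans (e L) (trans (+-congˡ (e′ L)) (trans
          (solve 3 (λ x y z → x :+ (y :+ z) := y :+ (x :+ z)) refl _ _ _)
          (+-congˡ (sym (trans (lin-++ L (scale a (newton b′)) p) (+-congʳ (lin-scale L a (newton b′))))))))

    Combination-Span : ∀ {B f} → Combination B f → Span B f
    Combination-Span (none f≐[]) L zs = f≐[] L
    Combination-Span (plus a i s e) L zs = trans (e L)
      (trans (+-cong (trans (*-congˡ (All.lookup zs i)) (zeroʳ a)) (Combination-Span s L zs)) (+-identityˡ 0#))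

    -- At the first node all later Newton polynomials vanish and the first has a unit value, so its
    -- coefficient is zero; then it is dropped.
    Combination-unique : ∀ B {f} → AllPairs Precedes B → All Own B → Combination B f →
      All (λ b → ev (proj₁ b) f ≈ 0#) B → f ≐ []
    Combination-unique [] pB uB s z L = Combination-Span s L []
    Combination-unique (b@(γ , _) ∷ B) {f} (pb ∷ pB) (ub ∷ uB) s (z ∷ zs)
      with a , p , t , e ← Combination-∷ s
      = λ L → trans (f≐p L) (Combination-unique B pB uB t
          (All.map (λ {b′} z → trans (sym (f≐p (mon (x (proj₁ b′))))) z) zs) L)
      where
      a≈0 : a ≈ 0#
      a≈0 = Unit-cancel ub (begin
        a * ev γ (newton b)           ≈⟨ +-identityʳ _ ⟨
        a * ev γ (newton b) + 0#      ≈⟨ +-congˡ (Combination-Span t (mon (x γ)) (All.map proj₂ pb)) ⟨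
        a * ev γ (newton b) + ev γ p  ≈⟨ e (mon (x γ)) ⟨
        ev γ f                        ≈⟨ z ⟩
        0#                            ∎)
      f≐p : f ≐ p
      f≐p L = trans (e L) (trans (+-congʳ (trans (*-congʳ a≈0) (zeroˡ _))) (+-identityˡ _))

    -- Interpolation at all nodes of bounded size.

    module Interpolation {S₀ : List (Fin n)} (adm₀ : Adm S₀ (V.replicate n 0))
                         (S₀-full : ∀ i → i ∈ S₀) where

      b₀ : Node
      b₀ = V.replicate n 0 , []

      basis : ℕ → List Node
      basis d = enum d S₀ b₀

      ∣0∣ : ∀ k → ∣ V.replicate k 0 ∣ ≡ 0
      ∣0∣ zero    = ≡.refl
      ∣0∣ (suc k) = ∣0∣ k

      d+∣0∣ : ∀ d → d ℕ.+ ∣ V.replicate n 0 ∣ ≡ d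
      d+∣0∣ d = ≡.trans (≡.cong (d ℕ.+_) (∣0∣ n)) (ℕ.+-identityʳ d)

      basis-Low : ∀ d → All Low (basis d)
      basis-Low d = enum-Low d S₀ b₀ []

      basis-size : ∀ d → All (λ b → ∣ proj₁ b ∣ ℕ.< d) (basis d)
      basis-size d = All.map (≡.subst (_ ℕ.<_) (d+∣0∣ d)) (enum-size d S₀ b₀)

      basis-Precedes : ∀ d → AllPairs Precedes (basis d)
      basis-Precedes d = enum-Precedes d S₀ b₀ adm₀

      basis-Own : ∀ d → All Own (basis d)
      basis-Own d = enum-Unit d S₀ b₀ adm₀ λ {γ} _ →
        Unit-resp (sym (trans (lin-mono (mon (x γ)) _) (mon-zero (x γ)))) (1# , *-identityˡ 1#)

      basis-complete : ∀ d {γ} → ∣ γ ∣ ℕ.< d → Any (λ b → proj₁ b ≡ γ) (basis d)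
      basis-complete d {γ} γ<d = enum-complete d S₀ b₀
        (above (λ i → ≡.subst (ℕ._≤ lookup γ i) (≡.sym (lookup-replicate i 0)) ℕ.z≤n)
               (λ i i∉ → contradiction (S₀-full i) i∉))
        (≡.subst (∣ γ ∣ ℕ.<_) (≡.sym (d+∣0∣ d)) γ<d)

      basis-lookup : ∀ {q} {Q : Comp n → Set q} d → All (λ b → Q (proj₁ b)) (basis d) →
                     ∀ {γ} → ∣ γ ∣ ℕ.< d → Q γ
      basis-lookup {Q = Q} d qs {γ} γ<d with b , b∈B , e ← find (basis-complete d {γ} γ<d) =
        ≡.subst Q e (All.lookup qs b∈B)

      -- The basis element with leading term x^m is x^m + ρ, so a x^m is `a` times it minus a ρ,
      -- where `ρ` has lower degree.
      basis-∷ : ∀ d a m {p} → ∣ m ∣ ℕ.< d →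
        (∀ ρ → DegreeBelow ∣ m ∣ ρ → Combination (basis d) ρ) →
        Combination (basis d) p → Combination (basis d) ((a , m) ∷ p)
      basis-∷ d a m {p} m<d lower-spans s
        with (.m , ρ) , b∈B , ≡.refl ← find (basis-complete d m<d) =
        plus a b∈B (Combination-++ (lower-spans (scale (- a) ρ)
          (All.map⁺ (All.lookup (basis-Low d) b∈B))) s)
        λ L → begin
          a * L m + lin L p
            ≈⟨ +-congʳ (+-identityʳ _) ⟨
          (a * L m + 0#) + lin L p
            ≈⟨ +-congʳ (+-congˡ (zeroˡ (lin L ρ))) ⟨
          (a * L m + 0# * lin L ρ) + lin L p
            ≈⟨ +-congʳ (+-congˡ (*-congʳ (-‿inverseʳ a))) ⟨
          -- The zero is inserted as `a - a` by hand, since the solver handles semirings and treats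
          -- `- a` as an atom.
          (a * L m + (a - a) * lin L ρ) + lin L p
            ≈⟨ solve 5 (λ a a′ l r p → (a :* l :+ (a :+ a′) :* r) :+ p
                 := a :* (l :+ r) :+ (a′ :* r :+ p)) refl a (- a) (L m) (lin L ρ) (lin L p) ⟩
          a * (L m + lin L ρ) + ((- a) * lin L ρ + lin L p)
            ≈⟨ +-cong (*-congˡ (+-congʳ (sym (*-identityˡ (L m)))))
                 (trans (+-congʳ (sym (lin-scale L (- a) ρ))) (sym (lin-++ L (scale (- a) ρ) p))) ⟩
          a * lin L (newton (m , ρ)) + lin L (scale (- a) ρ ++ p) ∎

      -- Lexicographic recursion: the call for `ρ` lowers the degree bound `k`, the call for the
      -- tail shortens the list.
      basis-spans : ∀ d k p → k ℕ.≤ d → DegreeBelow k p → Combination (basis d) p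
      basis-spans d k       []            k≤d []          = none λ _ → refl
      basis-spans d (suc k) ((a , m) ∷ p) k≤d (m≤k ∷ low) =
        basis-∷ d a m (ℕ.<-≤-trans m≤k k≤d)
          (λ ρ lowρ → basis-spans d k ρ (ℕ.<⇒≤ k≤d) (All.map (λ <m → ℕ.<-≤-trans <m (ℕ.s≤s⁻¹ m≤k)) lowρ))
          (basis-spans d (suc k) p k≤d low)

      vanishing : ∀ d f → (∀ m → d ℕ.≤ ∣ m ∣ → coeff f m ≈ 0#) →
                  (∀ γ → ∣ γ ∣ ℕ.< d → ev γ f ≈ 0#) → f ≐ []
      vanishing d f high≈0 ev≈0 L = trans (f≐ L)
        (Combination-unique (basis d) (basis-Precedes d) (basis-Own d)
          (basis-spans d d (truncate d f) ℕ.≤-refl (All.all-filter (λ t → ∣ proj₂ t ∣ ℕ.<? d) f))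
          (All.map (λ {b} <d → trans (sym (f≐ (mon (x (proj₁ b))))) (ev≈0 (proj₁ b) <d)) (basis-size d)) L)
        where
        f≐ : f ≐ truncate d f
        f≐ = truncate-≐ d f high≈0

      record Interpolates (γ : Comp n) (f : Poly) : Set (c ⊔ ℓ) where
        field
          degree  : ∀ m → ∣ γ ∣ ℕ.< ∣ m ∣ → coeff f m ≈ 0#
          leading : coeff f γ ≈ 1#
          vanish  : ∀ γ′ → γ′ ≢ γ → ∣ γ′ ∣ ℕ.≤ ∣ γ ∣ → ev γ′ f ≈ 0#
      open Interpolates public

      interpolant : ∀ γ → ∃ λ f → Interpolates γ f × Unit (ev γ f)
      interpolant γ
        -- `basis` has a strict size bound, so the successor is needed to include `γ` and the nodes
        -- of its own size.
        with f , fz , fu , f∈B , f1 ← lagrange (basis (suc ∣ γ ∣)) γ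
               (basis-Precedes (suc ∣ γ ∣)) (basis-Own (suc ∣ γ ∣)) (basis-Low (suc ∣ γ ∣))
               (All.map ℕ.s≤s⁻¹ (basis-size (suc ∣ γ ∣))) (basis-complete (suc ∣ γ ∣) ℕ.≤-refl)
        = f , record
          { degree  = λ m γ<m → f∈B (δ m) (All.zipWith (λ {b} (low , b≤γ) →
              newton-coeff-≢ {b} m low (ℕ.≤-trans (ℕ.s≤s⁻¹ b≤γ) (ℕ.<⇒≤ γ<m))
                λ { ≡.refl → ℕ.<⇒≱ γ<m (ℕ.s≤s⁻¹ b≤γ) })
              (basis-Low (suc ∣ γ ∣) , basis-size (suc ∣ γ ∣)))
          ; leading = f1
          ; vanish  = λ γ′ γ′≢γ γ′≤γ → basis-lookup (suc ∣ γ ∣) fz (ℕ.s≤s γ′≤γ) γ′≢γ } , fu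

-- Bar monomials over an abstract ring of coefficients.

module BarMonomials {c ℓ} (R : CommutativeRing c ℓ)
  {n : ℕ} {x : Comp n → Vec (CommutativeRing.Carrier R) n} {Adm : List (Fin n) → Comp n → Set}
  (nodes : Polynomials.Nodes R x Adm) {S₀ : List (Fin n)} (adm₀ : Adm S₀ (V.replicate n 0)) (S₀-full : ∀ i → i ∈ S₀)
  (d : Comp n → CommutativeRing.Carrier R) (d-unit : ∀ γ → Polynomials.Unit R (d γ)) where

  open CommutativeRing R hiding (zero) renaming (Carrier to C)
  open Polynomials R
  open SemiringSolver commutativeSemiring using (solve; _:=_; _:+_; _:*_)
  open SetoidReasoning setoid
  open RingProperties ring using (-1*x≈-x; -‿distribˡ-*)
  open Newton nodes
  open Interpolation adm₀ S₀-full

  top : ℕ → Poly {n} → Poly {n}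
  top k = filter (λ t → ∣ proj₂ t ∣ ℕ.≟ k)

  reflect : Poly {n} → Poly {n}
  reflect = map (λ (a , m) → (sgn ∣ m ∣ * a , m))

  Summand : Set c
  Summand = C × Comp n × Poly {n}

  Admissible : Summand → Set _
  Admissible (_ , γ , E) = Interpolates γ E

  index : Summand → ℕ
  index (_ , γ , _) = ∣ γ ∣

  termTop termBar : Summand → Poly {n}
  termTop (a , γ , E) = scale a (scale (d γ) (top ∣ γ ∣ E))
  termBar (a , γ , E) = scale a (scale (sgn ∣ γ ∣ * d γ) (reflect E))

  Σterm : (Summand → Poly {n}) → List Summand → Poly {n}
  Σterm f ts = L.foldr _++_ [] (map f ts)

  lin-Σterm : ∀ L f ts → lin L (Σterm f ts) ≈ sumOn (λ t → lin L (f t)) ts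
  lin-Σterm L f []       = refl
  lin-Σterm L f (t ∷ ts) = trans (lin-++ L (f t) (Σterm f ts)) (+-congˡ (lin-Σterm L f ts))

  lin-reflect : ∀ L p → lin L (reflect p) ≈ lin (λ m → sgn ∣ m ∣ * L m) p
  lin-reflect L p = trans (reflexive (sumOn-map _ _ p))
    (sumOn-cong (λ (a , m) → solve 3 (λ s a l → (s :* a) :* l := a :* (s :* l)) refl (sgn ∣ m ∣) a (L m)) p)

  -- The value of `L` on the full polynomial a d_γ E, from which both `termTop` and `termBar` are
  -- obtained, by selecting a degree or by inserting signs.
  weight : (Comp n → C) → Summand → C
  weight L (a , γ , E) = a * (d γ * lin L E)

  weight-zero : ∀ L {t} → lin L (proj₂ (proj₂ t)) ≈ 0# → weight L t ≈ 0#
  weight-zero L {a , γ , E} z = trans (*-congˡ (trans (*-congˡ z) (zeroʳ _))) (zeroʳ _)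

  coeff-termTop : ∀ m t → coeff (termTop t) m ≈ pick (index t ℕ.≟ ∣ m ∣) (weight (δ m) t)
  coeff-termTop m (a , γ , E) = begin
    coeff (scale a (scale (d γ) (top ∣ γ ∣ E))) m
      ≈⟨ trans (lin-scale (δ m) a (scale (d γ) (top ∣ γ ∣ E))) (*-congˡ (lin-scale (δ m) (d γ) (top ∣ γ ∣ E))) ⟩
    a * (d γ * coeff (top ∣ γ ∣ E) m)
      ≈⟨ *-congˡ (*-congˡ (trans (lin-filter (λ m′ → ∣ m′ ∣ ℕ.≟ ∣ γ ∣) (δ m) E)
           (lin-pick-δ (λ m′ → ∣ m′ ∣ ℕ.≟ ∣ γ ∣) m E))) ⟩
    a * (d γ * pick (∣ m ∣ ℕ.≟ ∣ γ ∣) (coeff E m))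
      ≈⟨ trans (*-congˡ (pick-*ˡ (∣ m ∣ ℕ.≟ ∣ γ ∣) (d γ) (coeff E m))) (pick-*ˡ (∣ m ∣ ℕ.≟ ∣ γ ∣) a _) ⟩
    pick (∣ m ∣ ℕ.≟ ∣ γ ∣) (weight (δ m) (a , γ , E))
      ≈⟨ pick-⇔ (∣ m ∣ ℕ.≟ ∣ γ ∣) (∣ γ ∣ ℕ.≟ ∣ m ∣) ≡.sym ≡.sym ⟩
    pick (∣ γ ∣ ℕ.≟ ∣ m ∣) (weight (δ m) (a , γ , E)) ∎
    where
    pick-⇔ : ∀ {P Q : Set} (P? : Dec P) (Q? : Dec Q) {y} → (P → Q) → (Q → P) → pick P? y ≈ pick Q? y
    pick-⇔ (yes p) Q? f g = sym (pick-yes Q? (f p))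
    pick-⇔ (no ¬p) Q? f g = sym (pick-no Q? (¬p ∘ g))

  lin-termBar : ∀ L t → lin L (termBar t) ≈ sgn (index t) * weight (λ m → sgn ∣ m ∣ * L m) t
  lin-termBar L (a , γ , E) = begin
    lin L (scale a (scale (sgn ∣ γ ∣ * d γ) (reflect E)))
      ≈⟨ trans (lin-scale L a (scale (sgn ∣ γ ∣ * d γ) (reflect E)))
           (*-congˡ (trans (lin-scale L (sgn ∣ γ ∣ * d γ) (reflect E)) (*-congˡ (lin-reflect L E)))) ⟩
    a * ((sgn ∣ γ ∣ * d γ) * lin (λ m → sgn ∣ m ∣ * L m) E)
      ≈⟨ solve 4 (λ a s d l → a :* ((s :* d) :* l) := s :* (a :* (d :* l))) refl a (sgn ∣ γ ∣) (d γ) _ ⟩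
    sgn ∣ γ ∣ * (a * (d γ * lin (λ m → sgn ∣ m ∣ * L m) E)) ∎

  sgn-δ : ∀ (m m′ : Comp n) → sgn ∣ m′ ∣ * δ m m′ ≈ sgn ∣ m ∣ * δ m m′
  sgn-δ m m′ with m′ ≟ m
  ... | yes ≡.refl = refl
  ... | no  _      = trans (zeroʳ _) (sym (zeroʳ _))

  ev⁻ : Comp n → Poly {n} → C
  ev⁻ γ = lin (mon (V.map -_ (x γ)))

  -- The sign from reflecting the polynomial cancels the one from negating the point.
  ev⁻-sgn : ∀ γ p → lin (λ m → sgn ∣ m ∣ * mon (V.map -_ (x γ)) m) p ≈ ev γ p
  ev⁻-sgn γ = lin-cong λ m → begin
    sgn ∣ m ∣ * mon (V.map -_ (x γ)) m           ≈⟨ *-congˡ (mon-neg (x γ) m) ⟩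
    sgn ∣ m ∣ * (sgn ∣ m ∣ * mon (x γ) m)         ≈⟨ *-assoc _ _ _ ⟨
    (sgn ∣ m ∣ * sgn ∣ m ∣) * mon (x γ) m         ≈⟨ trans (*-congʳ (sgn-square ∣ m ∣)) (*-identityˡ _) ⟩
    mon (x γ) m                                   ∎

  record Characterised (η : Comp n) (g : Poly {n}) : Set (c ⊔ ℓ) where
    field
      monic   : ∀ m → ∣ η ∣ ℕ.≤ ∣ m ∣ → coeff (g ++ scale (- 1#) (mono η)) m ≈ 0#
      vanish⁻ : ∀ γ → ∣ γ ∣ ℕ.< ∣ η ∣ → ev⁻ γ g ≈ 0#
  open Characterised public

  -- `vanishing` concerns the points γ̄, while the conditions concern their negatives. So it is
  -- applied to the reflected difference, and reflecting twice gives the difference back.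
  characterised-unique : ∀ η g h → Characterised η g → Characterised η h → ∀ m → coeff g m ≈ coeff h m
  characterised-unique η g h G H m = begin
    coeff g m
      ≈⟨ +-identityʳ _ ⟨
    coeff g m + 0#
      ≈⟨ +-congˡ (-‿inverseˡ (coeff h m)) ⟨
    coeff g m + (- coeff h m + coeff h m)
      ≈⟨ +-assoc _ _ _ ⟨
    (coeff g m - coeff h m) + coeff h m
      ≈⟨ +-congʳ (lin-f (δ m)) ⟨
    coeff f m + coeff h m
      ≈⟨ +-congʳ (lin-cong (λ m′ → trans (sym (trans (*-congʳ (sgn-square ∣ m′ ∣)) (*-identityˡ _))) (*-assoc _ _ _)) f) ⟩
    lin (λ m′ → sgn ∣ m′ ∣ * (sgn ∣ m′ ∣ * δ m m′)) f + coeff h m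
      ≈⟨ +-congʳ (lin-reflect (λ m′ → sgn ∣ m′ ∣ * δ m m′) f) ⟨
    lin (λ m′ → sgn ∣ m′ ∣ * δ m m′) (reflect f) + coeff h m
      ≈⟨ +-congʳ (vanishing ∣ η ∣ (reflect f) high low _) ⟩
    0# + coeff h m
      ≈⟨ +-identityˡ _ ⟩
    coeff h m ∎
    where
    f : Poly {n}
    f = g ++ scale (- 1#) h
    lin-f : ∀ L → lin L f ≈ lin L g - lin L h
    lin-f L = trans (lin-++ L g _) (+-congˡ (trans (lin-scale L (- 1#) h) (-1*x≈-x _)))
    coeff-g : ∀ {g} → Characterised η g → ∀ m → ∣ η ∣ ℕ.≤ ∣ m ∣ → coeff g m ≈ coeff (mono η) m
    coeff-g {g} G m η≤m = RingProperties.x∙y⁻¹≈ε⇒x≈y ring _ _ (trans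
      (sym (trans (lin-++ (δ m) g _) (+-congˡ (trans (lin-scale (δ m) (- 1#) (mono η)) (-1*x≈-x _)))))
      (monic G m η≤m))
    high : ∀ m → ∣ η ∣ ℕ.≤ ∣ m ∣ → coeff (reflect f) m ≈ 0#
    high m η≤m = trans (lin-reflect (δ m) f) (trans (trans (lin-cong {L = λ m′ → sgn ∣ m′ ∣ * δ m m′} (sgn-δ m) f) (lin-*ˡ (sgn ∣ m ∣) (δ m) f)) (trans (*-congˡ
      (trans (lin-f (δ m)) (trans (+-congʳ (trans (coeff-g G m η≤m) (sym (coeff-g H m η≤m)))) (-‿inverseʳ _))))
      (zeroʳ _)))
    low : ∀ γ → ∣ γ ∣ ℕ.< ∣ η ∣ → ev γ (reflect f) ≈ 0#
    low γ γ<η = trans (lin-reflect (mon (x γ)) f) (trans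
      (lin-cong (λ m → sym (mon-neg (x γ) m)) f) (trans (lin-f _)
        (trans (+-cong (vanish⁻ G γ γ<η) (-‿cong (vanish⁻ H γ γ<η))) (-‿inverseʳ 0#))))

  -- The slices |γ| = k of an expansion of x^η.

  module _ (η : Comp n) (ts : List Summand) (ok : All Admissible ts)
           (η≐ : ∀ m → coeff (mono η) m ≈ coeff (Σterm termTop ts) m) where

    slice : ℕ → (Comp n → C) → C
    slice k L = sumOn (λ t → pick (index t ℕ.≟ k) (weight L t)) ts

    slice-zero : ∀ {k L} → (∀ {t} → Admissible t → index t ≡ k → weight L t ≈ 0#) → slice k L ≈ 0#
    slice-zero {k} z = sumOn-zero (All.map (λ {t} t-ok → pick-zero (index t ℕ.≟ k) (z t-ok)) ok)

    slice-above : ∀ k m → k ℕ.< ∣ m ∣ → slice k (δ m) ≈ 0#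
    slice-above k m k<m = slice-zero λ {t} E t≡k →
      weight-zero (δ m) {t} (degree E m (≡.subst (ℕ._< ∣ m ∣) (≡.sym t≡k) k<m))

    slice-below : ∀ k γ → ∣ γ ∣ ℕ.< k → slice k (mon (x γ)) ≈ 0#
    slice-below k γ γ<k = slice-zero λ {t} E t≡k → weight-zero (mon (x γ)) {t}
      (vanish E γ (λ { ≡.refl → ℕ.<-irrefl t≡k γ<k }) (≡.subst (∣ γ ∣ ℕ.≤_) (≡.sym t≡k) (ℕ.<⇒≤ γ<k)))

    -- Only summands with |γ| = |m| have a top component in degree |m|, so a single slice accounts
    -- for the coefficient of x^m.
    slice-top : ∀ m → slice ∣ m ∣ (δ m) ≈ coeff (mono η) m
    slice-top m = begin
      slice ∣ m ∣ (δ m)                   ≈⟨ sumOn-cong (coeff-termTop m) ts ⟨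
      sumOn (λ t → coeff (termTop t) m) ts ≈⟨ lin-Σterm (δ m) termTop ts ⟨
      coeff (Σterm termTop ts) m          ≈⟨ η≐ m ⟨
      coeff (mono η) m                    ∎

    slicePoly : ℕ → Poly {n}
    slicePoly k = Σterm (λ (a , γ , E) → scale a (scale (d γ) E)) (filter (λ t → index t ℕ.≟ k) ts)

    lin-slicePoly : ∀ k L → lin L (slicePoly k) ≈ slice k L
    lin-slicePoly k L = trans (lin-Σterm L _ (filter (λ t → index t ℕ.≟ k) ts))
      (trans (sumOn-filter (λ t → index t ℕ.≟ k) _ ts)
        (sumOn-cong (λ t@(a , γ , E) → pick-cong (index t ℕ.≟ k) λ _ →
          trans (lin-scale L a (scale (d γ) E)) (*-congˡ (lin-scale L (d γ) E))) ts))

    -- The top component of this slice is that of x^η, hence zero, so `vanishing` applies.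
    slice-≢ : ∀ k → k ≢ ∣ η ∣ → ∀ L → slice k L ≈ 0#
    slice-≢ k k≢η L = trans (sym (lin-slicePoly k L)) (vanishing k (slicePoly k)
      (λ m k≤m → trans (lin-slicePoly k (δ m))
        ([ slice-above k m , (λ { ≡.refl → trans (slice-top m)
             (trans (lin-mono (δ m) η) (pick-no (η ≟ m) λ { ≡.refl → k≢η ≡.refl })) }) ]′
         (ℕ.m≤n⇒m<n∨m≡n k≤m)))
      (λ γ γ<k → trans (lin-slicePoly k (mon (x γ))) (slice-below k γ γ<k)) L)

    -- Once `slice-≢` has removed the other slices, the sign (-1)^|γ| is constant and can be pulled
    -- out.
    lin-ΣtermBar : ∀ L → lin L (Σterm termBar ts) ≈ sgn ∣ η ∣ * slice ∣ η ∣ (λ m → sgn ∣ m ∣ * L m)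
    lin-ΣtermBar L = begin
      lin L (Σterm termBar ts)
        ≈⟨ trans (lin-Σterm L termBar ts) (sumOn-cong (lin-termBar L) ts) ⟩
      sumOn (λ t → sgn (index t) * weight L′ t) ts
        ≈⟨ sumOn-fibre ℕ._≟_ index ∣ η ∣ _ ts (λ k k≢η → trans (fibre k) (trans (*-congˡ (slice-≢ k k≢η L′)) (zeroʳ _))) ⟩
      sumOn (λ t → pick (index t ℕ.≟ ∣ η ∣) (sgn (index t) * weight L′ t)) ts
        ≈⟨ fibre ∣ η ∣ ⟩
      sgn ∣ η ∣ * slice ∣ η ∣ L′ ∎
      where
      L′ : Comp n → C
      L′ m = sgn ∣ m ∣ * L m
      fibre : ∀ k → sumOn (λ t → pick (index t ℕ.≟ k) (sgn (index t) * weight L′ t)) ts ≈ sgn k * slice k L′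
      fibre k = trans (sumOn-cong (λ t → trans
        (pick-cong (index t ℕ.≟ k) λ { ≡.refl → refl })
        (sym (pick-*ˡ (index t ℕ.≟ k) (sgn k) (weight L′ t)))) ts) (sumOn-*ˡ (sgn k) _ ts)

    slice-cong : ∀ k {L L′} → (∀ m → L m ≈ L′ m) → slice k L ≈ slice k L′
    slice-cong k L≈L′ = sumOn-cong (λ t@(a , γ , E) → pick-cong (index t ℕ.≟ k) λ _ →
      *-congˡ (*-congˡ (lin-cong L≈L′ E))) ts

    slice-*ˡ : ∀ k a L → slice k (λ m → a * L m) ≈ a * slice k L
    slice-*ˡ k a L = trans (sumOn-cong (λ t@(b , γ , E) → trans
      (pick-cong (index t ℕ.≟ k) λ _ → trans (*-congˡ (*-congˡ (lin-*ˡ a L E)))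
        (solve 4 (λ a b d l → b :* (d :* (a :* l)) := a :* (b :* (d :* l))) refl a b (d γ) (lin L E)))
      (sym (pick-*ˡ (index t ℕ.≟ k) a _))) ts) (sumOn-*ˡ a _ ts)

    bar-characterised : ∀ g → (∀ m → coeff g m ≈ coeff (Σterm termBar ts) m) → Characterised η g
    bar-characterised g g≈ = record { monic = monic-g ; vanish⁻ = vanish-g }
      where
      g≐ : ∀ L → lin L g ≈ sgn ∣ η ∣ * slice ∣ η ∣ (λ m → sgn ∣ m ∣ * L m)
      g≐ L = trans (coeff-ext g (Σterm termBar ts) g≈ L) (lin-ΣtermBar L)
      vanish-g : ∀ γ → ∣ γ ∣ ℕ.< ∣ η ∣ → ev⁻ γ g ≈ 0#
      vanish-g γ γ<η = trans (g≐ _) (trans (*-congˡ (trans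
        (sumOn-cong (λ t@(a , γ′ , E) → pick-cong (index t ℕ.≟ ∣ η ∣) λ _ → *-congˡ (*-congˡ (ev⁻-sgn γ E))) ts)
        (slice-below ∣ η ∣ γ γ<η))) (zeroʳ _))
      slice-δ : ∀ k m → slice k (λ m′ → sgn ∣ m′ ∣ * δ m m′) ≈ sgn ∣ m ∣ * slice k (δ m)
      slice-δ k m = trans (slice-cong k (sgn-δ m)) (slice-*ˡ k (sgn ∣ m ∣) (δ m))
      coeff-g : ∀ m → ∣ η ∣ ℕ.≤ ∣ m ∣ → coeff g m ≈ coeff (mono η) m
      coeff-g m η≤m = trans (g≐ (δ m)) (trans (*-congˡ (slice-δ ∣ η ∣ m)) (split (ℕ.m≤n⇒m<n∨m≡n η≤m)))
        where
        split : ∣ η ∣ ℕ.< ∣ m ∣ ⊎ ∣ η ∣ ≡ ∣ m ∣ →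
                sgn ∣ η ∣ * (sgn ∣ m ∣ * slice ∣ η ∣ (δ m)) ≈ coeff (mono η) m
        split (inj₁ η<m) = trans
          (trans (*-congˡ (trans (*-congˡ (slice-above ∣ η ∣ m η<m)) (zeroʳ _))) (zeroʳ _))
          (sym (trans (lin-mono (δ m) η) (pick-no (η ≟ m) λ { ≡.refl → ℕ.<-irrefl ≡.refl η<m })))
        -- In degree ∣ η ∣ the sign of the slice and that of the reflection agree and cancel.
        split (inj₂ η≡m) = ≡.subst
          (λ k → sgn k * (sgn ∣ m ∣ * slice k (δ m)) ≈ coeff (mono η) m) (≡.sym η≡m)
          (trans (sym (*-assoc _ _ _)) (trans (*-congʳ (sgn-square ∣ m ∣))
            (trans (*-identityˡ _) (slice-top m))))
      monic-g : ∀ m → ∣ η ∣ ℕ.≤ ∣ m ∣ → coeff (g ++ scale (- 1#) (mono η)) m ≈ 0#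
      monic-g m η≤m = trans (lin-++ (δ m) g _) (trans
        (+-cong (coeff-g m η≤m) (trans (lin-scale (δ m) (- 1#) (mono η)) (-1*x≈-x _))) (-‿inverseʳ _))

  -- Existence of an expansion of x^η.

  eliminate-node : ∀ k {Γ γ g E i} → Interpolates γ E → ∣ γ ∣ ≡ k → ev γ E * i ≈ 1# →
    (∀ γ′ → ∣ γ′ ∣ ℕ.≤ k → ∣ γ′ ∣ ≢ k ⊎ γ′ ∉ γ ∷ Γ → ev γ′ g ≈ 0#) →
    ∀ γ′ → ∣ γ′ ∣ ℕ.≤ k → ∣ γ′ ∣ ≢ k ⊎ γ′ ∉ Γ → ev γ′ (g ++ scale (- (ev γ g * i)) E) ≈ 0#
  eliminate-node k {Γ} {γ} {g} {E} {i} E-ok ≡.refl Ei≈1 z γ′ γ′≤k s =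
    trans (lin-++ _ g _) (trans (+-congˡ (lin-scale _ _ E)) (by-cases (γ′ ≟ γ)))
    where
    by-cases : Dec (γ′ ≡ γ) → ev γ′ g + (- (ev γ g * i)) * ev γ′ E ≈ 0#
    by-cases (yes ≡.refl) = begin
      ev γ g + (- (ev γ g * i)) * ev γ E
        ≈⟨ +-congˡ (-‿distribˡ-* _ _) ⟨
      ev γ g - (ev γ g * i) * ev γ E
        ≈⟨ +-congˡ (-‿cong (trans (solve 3 (λ g i e → (g :* i) :* e := g :* (e :* i)) refl (ev γ g) i (ev γ E))
             (trans (*-congˡ Ei≈1) (*-identityʳ _)))) ⟩
      ev γ g - ev γ g
        ≈⟨ -‿inverseʳ _ ⟩
      0# ∎
    by-cases (no γ′≢γ) = trans
      (+-cong (z γ′ γ′≤k (Sum.map₂ (λ γ′∉ → λ { (here e) → γ′≢γ e ; (there i) → γ′∉ i }) s))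
        (trans (*-congˡ (vanish E-ok γ′ γ′≢γ γ′≤k)) (zeroʳ _)))
      (+-identityʳ 0#)

  add-back : ∀ u a e → u ≈ a * e + (u + (- a) * e)
  add-back u a e = begin
    u                          ≈⟨ trans (+-congˡ (zeroˡ e)) (+-identityʳ u) ⟨
    u + 0# * e                 ≈⟨ +-congˡ (*-congʳ (-‿inverseʳ a)) ⟨
    u + (a - a) * e            ≈⟨ solve 4 (λ u a a′ e → u :+ (a :+ a′) :* e := a :* e :+ (u :+ a′ :* e)) refl u a (- a) e ⟩
    a * e + (u + (- a) * e)    ∎

  -- `Γ` lists the nodes of size `k` at which `g` may still be nonzero. Subtracting the multiple of
  -- E_γ with the same value at `γ` clears `γ` and disturbs no other node of size at most `k`. When
  -- `Γ` is exhausted, `vanishing` shows that nothing remains.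
  eliminate : ∀ k (Γ : List (Comp n)) g →
    (∀ m → k ℕ.< ∣ m ∣ → coeff g m ≈ 0#) →
    (∀ γ → ∣ γ ∣ ℕ.≤ k → ∣ γ ∣ ≢ k ⊎ γ ∉ Γ → ev γ g ≈ 0#) →
    ∃ λ ts → All (λ t → index t ≡ k × Admissible t) ts
           × (∀ L → lin L g ≈ sumOn (λ (a , γ , E) → a * lin L E) ts)
  eliminate k []      g high z =
    [] , [] , vanishing (suc k) g high (λ γ γ≤k → z γ (ℕ.s≤s⁻¹ γ≤k) (inj₂ λ ()))
  eliminate k (γ ∷ Γ) g high z with ∣ γ ∣ ℕ.≟ k
  -- `Γ` may hold compositions of other sizes; `g` vanishes there in any case, so they are skipped.
  ... | no  γ≢k = eliminate k Γ g high λ γ′ γ′≤k s → z γ′ γ′≤k (step′ (∣ γ′ ∣ ℕ.≟ k) s)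
    where
    step′ : ∀ {γ′} → Dec (∣ γ′ ∣ ≡ k) → ∣ γ′ ∣ ≢ k ⊎ γ′ ∉ Γ → ∣ γ′ ∣ ≢ k ⊎ γ′ ∉ γ ∷ Γ
    step′ _       (inj₁ ≢k)  = inj₁ ≢k
    step′ (no ≢k) (inj₂ _)   = inj₁ ≢k
    step′ (yes e) (inj₂ γ′∉) = inj₂ λ { (here ≡.refl) → γ≢k e ; (there i) → γ′∉ i }
  ... | yes ≡.refl
    with E , E-ok , (i , Ei≈1) ← interpolant γ
    with ts , ts-ok , g′≈ ← eliminate k Γ (g ++ scale (- (ev γ g * i)) E)
           (λ m k<m → trans (lin-++ (δ m) g _) (trans (+-cong (high m k<m)
              (trans (lin-scale (δ m) _ E) (trans (*-congˡ (degree E-ok m k<m)) (zeroʳ _)))) (+-identityʳ _)))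
           (eliminate-node k {g = g} E-ok ≡.refl Ei≈1 z)
    = (ev γ g * i , γ , E) ∷ ts , (≡.refl , E-ok) ∷ ts-ok , λ L →
      trans (add-back (lin L g) (ev γ g * i) (lin L E))
        (+-congˡ (trans (sym (trans (lin-++ L g _) (+-congˡ (lin-scale L _ E)))) (g′≈ L)))

  -- `termTop` multiplies by `d γ`, so a coefficient with respect to E_γ has to be divided by it.
  normalise : Summand → Summand
  normalise (a , γ , E) = a * proj₁ (d-unit γ) , γ , E

  weight-normalise : ∀ L t → weight L (normalise t) ≈ proj₁ t * lin L (proj₂ (proj₂ t))
  weight-normalise L (a , γ , E) = trans
    (solve 4 (λ a i d l → (a :* i) :* (d :* l) := (a :* (d :* i)) :* l) refl a _ (d γ) (lin L E))
    (*-congʳ (trans (*-congˡ (proj₂ (d-unit γ))) (*-identityʳ a)))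

  Span-coeff : ∀ η h → Span (basis ∣ η ∣) h → ∀ m → ∣ η ∣ ℕ.≤ ∣ m ∣ → coeff (mono η ++ h) m ≈ coeff (mono η) m
  Span-coeff η h h∈B m η≤m = trans (lin-++ (δ m) (mono η) h) (trans (+-congˡ (h∈B (δ m)
    (All.zipWith (λ {b} (low , b<η) → newton-coeff-≢ {b} m low (ℕ.≤-trans (ℕ.<⇒≤ b<η) η≤m)
      λ { ≡.refl → ℕ.<⇒≱ b<η η≤m }) (basis-Low ∣ η ∣ , basis-size ∣ η ∣)))) (+-identityʳ _))

  smaller : ∀ (η γ : Comp n) → ∣ γ ∣ ℕ.≤ ∣ η ∣ → ∣ γ ∣ ≢ ∣ η ∣ ⊎ γ ∉ map proj₁ (basis (suc ∣ η ∣)) → ∣ γ ∣ ℕ.< ∣ η ∣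
  smaller η γ γ≤η (inj₁ γ≢η) = ℕ.≤∧≢⇒< γ≤η γ≢η
  smaller η γ γ≤η (inj₂ γ∉)
    with b , b∈B , ≡.refl ← find (basis-complete (suc ∣ η ∣) {γ} (ℕ.s≤s γ≤η)) =
    contradiction (∈-map⁺ proj₁ b∈B) γ∉

  sumOn-pick : ∀ (η : Comp n) {ts : List Summand} {g m} (η≟m : Dec (∣ η ∣ ≡ ∣ m ∣)) →
    coeff g m ≈ sumOn (λ (a , γ , E) → a * coeff E m) ts →
    (∣ η ∣ ℕ.≤ ∣ m ∣ → coeff g m ≈ coeff (mono η) m) →
    sumOn (λ (a , γ , E) → pick η≟m (a * coeff E m)) ts ≈ coeff (mono η) m
  sumOn-pick η (yes η≡m) g≈ g≈η = trans (sym g≈) (g≈η (ℕ.≤-reflexive η≡m))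
  sumOn-pick η {ts} {m = m} (no η≢m) g≈ g≈η = trans (sumOn-zero (All.universal (λ _ → refl) ts))
    (sym (trans (lin-mono (δ m) η) (pick-no (η ≟ m) λ { ≡.refl → η≢m ≡.refl })))

  -- A correction `h` of degree below |η| makes x^η + h vanish at all smaller nodes, so `eliminate`
  -- expresses it through E_γ with |γ| = |η|. In degree |η| the correction is invisible, and
  -- comparing top components gives the expansion of x^η.
  mono-expansion : ∀ η → ∃ λ ts → All Admissible ts ×
    (∀ m → coeff (mono η) m ≈ coeff (Σterm termTop ts) m)
  mono-expansion η
    with h , h≈ , h∈B ← interpolate (basis ∣ η ∣) (basis-Precedes ∣ η ∣) (basis-Own ∣ η ∣)
           (λ γ → - ev γ (mono η))
    with ts , ts-ok , g≈ ← eliminate ∣ η ∣ (map proj₁ (basis (suc ∣ η ∣))) (mono η ++ h)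
           (λ m η<m → trans (Span-coeff η h h∈B m (ℕ.<⇒≤ η<m))
              (trans (lin-mono (δ m) η) (pick-no (η ≟ m) λ { ≡.refl → ℕ.<-irrefl ≡.refl η<m })))
           (λ γ γ≤η s → trans (lin-++ _ (mono η) h)
              (trans (+-congˡ (basis-lookup {Q = λ γ → ev γ h ≈ - ev γ (mono η)} ∣ η ∣ h≈ (smaller η γ γ≤η s))) (-‿inverseʳ _)))
    = map normalise ts , All.map⁺ (All.map proj₂ ts-ok) , λ m → sym (begin
      coeff (Σterm termTop (map normalise ts)) m
        ≈⟨ trans (lin-Σterm (δ m) termTop (map normalise ts)) (reflexive (sumOn-map _ normalise ts)) ⟩
      sumOn (λ t → coeff (termTop (normalise t)) m) ts
        ≈⟨ sumOn-All-cong (All.map (λ {t} (t≡η , _) → trans (coeff-termTop m (normalise t))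
             (trans (pick-cong (index t ℕ.≟ ∣ m ∣) (λ _ → weight-normalise (δ m) t))
               (reflexive (≡.cong (λ k → pick (k ℕ.≟ ∣ m ∣) _) t≡η)))) ts-ok) ⟩
      sumOn (λ (a , γ , E) → pick (∣ η ∣ ℕ.≟ ∣ m ∣) (a * coeff E m)) ts
        ≈⟨ sumOn-pick η {ts} {mono η ++ h} (∣ η ∣ ℕ.≟ ∣ m ∣) (g≈ (δ m)) (Span-coeff η h h∈B m) ⟩
      coeff (mono η) m ∎)

-- The sorted order of a composition

module _ {a} {A : Set a} where

  indicator : ∀ {p} {P : Set p} → Dec P → ℕ
  indicator (yes _) = 1
  indicator (no _)  = 0

  length-filter-∷ : ∀ {P : A → Set} (P? : Decidable P) x xs →
    length (filter P? (x ∷ xs)) ≡ indicator (P? x) ℕ.+ length (filter P? xs)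
  length-filter-∷ P? x xs with P? x
  ... | yes _ = ≡.refl
  ... | no  _ = ≡.refl

  indicators-≤ : ∀ {P Q P′ Q′ : Set} (P? : Dec P) (Q? : Dec Q) (P′? : Dec P′) (Q′? : Dec Q′) →
    (P → ¬ Q) → (P ⊎ Q → P′ ⊎ Q′) →
    indicator P? ℕ.+ indicator Q? ℕ.≤ indicator P′? ℕ.+ indicator Q′?
  indicators-≤ (no _)  (no _)  _        _        disj sub = ℕ.z≤n
  indicators-≤ (yes p) (yes q) _        _        disj sub = contradiction q (disj p)
  indicators-≤ (yes p) (no _)  (yes _)  _        disj sub = ℕ.s≤s ℕ.z≤n
  indicators-≤ (yes p) (no _)  (no _)   (yes _)  disj sub = ℕ.s≤s ℕ.z≤n
  indicators-≤ (yes p) (no _)  (no ¬p′) (no ¬q′) disj sub =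
    [ (λ p′ → contradiction p′ ¬p′) , (λ q′ → contradiction q′ ¬q′) ]′ (sub (inj₁ p))
  indicators-≤ (no _)  (yes q) (yes _)  _        disj sub = ℕ.s≤s ℕ.z≤n
  indicators-≤ (no _)  (yes q) (no _)   (yes _)  disj sub = ℕ.s≤s ℕ.z≤n
  indicators-≤ (no _)  (yes q) (no ¬p′) (no ¬q′) disj sub =
    [ (λ p′ → contradiction p′ ¬p′) , (λ q′ → contradiction q′ ¬q′) ]′ (sub (inj₂ q))

  -- Tailored to `posγ`, a sum of two counts. Disjointness on the left prevents an element from
  -- being counted twice there; an overlap on the right would only help.
  length-filters-≤ : ∀ {P Q P′ Q′ : A → Set}
    (P? : Decidable P) (Q? : Decidable Q) (P′? : Decidable P′) (Q′? : Decidable Q′) →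
    (∀ x → P x → ¬ Q x) → (∀ x → P x ⊎ Q x → P′ x ⊎ Q′ x) → ∀ xs →
    length (filter P? xs) ℕ.+ length (filter Q? xs) ℕ.≤ length (filter P′? xs) ℕ.+ length (filter Q′? xs)
  length-filters-≤ P? Q? P′? Q′? disj sub []       = ℕ.z≤n
  length-filters-≤ P? Q? P′? Q′? disj sub (x ∷ xs) = ≡.subst₂ ℕ._≤_
    (≡.sym (regroup P? Q?)) (≡.sym (regroup P′? Q′?))
    (ℕ.+-mono-≤ (indicators-≤ (P? x) (Q? x) (P′? x) (Q′? x) (disj x) (sub x))
      (length-filters-≤ P? Q? P′? Q′? disj sub xs))
    where
    regroup : ∀ {P Q : A → Set} (P? : Decidable P) (Q? : Decidable Q) →
      length (filter P? (x ∷ xs)) ℕ.+ length (filter Q? (x ∷ xs))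
      ≡ (indicator (P? x) ℕ.+ indicator (Q? x)) ℕ.+ (length (filter P? xs) ℕ.+ length (filter Q? xs))
    regroup P? Q? = ≡.trans
      (≡.cong₂ ℕ._+_ (length-filter-∷ P? x xs) (length-filter-∷ Q? x xs))
      (solve 4 (λ a b c d → (a :+ b) :+ (c :+ d) := (a :+ c) :+ (b :+ d)) ≡.refl
        (indicator (P? x)) (length (filter P? xs)) (indicator (Q? x)) (length (filter Q? xs)))
      where open +-*-Solver

-- An entry b at coordinate k is placed before an entry a at coordinate i by the
-- stable decreasing sort, so posγ γ i counts the k with Before (γ i) i (γ k) k.
Before : ∀ {n} → ℕ → Fin n → ℕ → Fin n → Set
Before a i b k = a ℕ.< b ⊎ (k Fin.< i × b ≡ a)

module _ {n : ℕ} {i k : Fin n} where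

  Before-mono : ∀ {a b b′} → b ℕ.≤ b′ → Before a i b k → Before a i b′ k
  Before-mono b≤b′ (inj₁ a<b) = inj₁ (ℕ.<-≤-trans a<b b≤b′)
  Before-mono b≤b′ (inj₂ (k<i , ≡.refl)) with ℕ.m≤n⇒m<n∨m≡n b≤b′
  ... | inj₁ b<b′   = inj₁ b<b′
  ... | inj₂ ≡.refl = inj₂ (k<i , ≡.refl)

  Before-suc : ∀ {a b} → Before a i b k → Before (suc a) i (suc b) k
  Before-suc = Sum.map ℕ.s≤s λ (k<i , e) → k<i , ≡.cong suc e

  Before-asym : ∀ {a b} → Before a i b k → ¬ Before b k a i
  Before-asym (inj₁ a<b)            (inj₁ b<a)            = ℕ.<-asym a<b b<a
  Before-asym (inj₁ a<b)            (inj₂ (_ , ≡.refl))   = ℕ.<-irrefl ≡.refl a<b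
  Before-asym (inj₂ (_ , ≡.refl))   (inj₁ b<a)            = ℕ.<-irrefl ≡.refl b<a
  Before-asym (inj₂ (k<i , _))      (inj₂ (i<k , _))      = ℕ.<-asym k<i i<k

Before-irrefl : ∀ {n a} {i : Fin n} → ¬ Before a i a i
Before-irrefl b = Before-asym b b

posγ-≤ : ∀ {n} (β γ : Comp n) i →
  (∀ k → Before (lookup γ i) i (lookup γ k) k → Before (lookup β i) i (lookup β k) k) →
  posγ γ i ℕ.≤ posγ β i
posγ-≤ {n} β γ i sub = length-filters-≤ _ _ _ _
  (λ { k γi<γk (_ , γk≡γi) → ℕ.<-irrefl (≡.sym γk≡γi) γi<γk }) sub (allFin n)

-- S lists the free coordinates from the last to the first place in the sorted order of β,
-- they stay sorted cyclically when raised in turn, and the frozen coordinates come last.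
record Sorted {n} (S : List (Fin n)) (β : Comp n) : Set where
  field
    cyclic : AllPairs (λ s t → Before (lookup β s) s (lookup β t) t
                             × Before (lookup β t) t (suc (lookup β s)) s) S
    free   : ∀ {f s} → f ∉ S → s ∈ S → Before (lookup β f) f (lookup β s) s
open Sorted

module _ {n : ℕ} {S : List (Fin n)} {β : Comp n} {j : Fin n} where

  Sorted-freeze : Sorted (j ∷ S) β → Sorted S β
  Sorted-freeze o = record { cyclic = AllPairs.tail (cyclic o) ; free = free′ }
    where
    free′ : ∀ {f s} → f ∉ S → s ∈ S → Before (lookup β f) f (lookup β s) s
    free′ {f} f∉ s∈ with f Fin.≟ j
    -- The newly frozen `j` was the head of the list, hence already behind every remaining free
    -- coordinate.
    ... | yes ≡.refl = proj₁ (All.lookup (AllPairs.head (cyclic o)) s∈)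
    ... | no  f≢j    = free o (λ { (here e) → f≢j e ; (there i) → f∉ i }) (there s∈)

  Sorted-fresh : Sorted (j ∷ S) β → j ∉ S
  Sorted-fresh o j∈S = Before-irrefl {a = lookup β j} {i = j} (proj₁ (All.lookup (AllPairs.head (cyclic o)) j∈S))

  -- Raising carries `j` from the last place among the free coordinates to the first, hence to the
  -- end of the list. For the pair of `j` and `s`, the old second condition becomes the new first
  -- one, and the old first condition, with both entries increased, becomes the new second one.
  Sorted-raise : Sorted (j ∷ S) β → Sorted (S ++ j ∷ []) (raise β j)
  Sorted-raise o = record
    { cyclic = AllPairs.++⁺ (kept S id (AllPairs.tail (cyclic o))) ([] ∷ [])
        (All.tabulate λ {s} s∈ → (last s∈ ∷ []))
    ; free = free′ }
    where
    ≢j : ∀ {s} → s ∈ S → s ≢ j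
    ≢j s∈ ≡.refl = Sorted-fresh o s∈
    R : Comp n → Fin n → Fin n → Set
    R β s t = Before (lookup β s) s (lookup β t) t × Before (lookup β t) t (suc (lookup β s)) s
    kept-R : ∀ {s t} → s ≢ j → t ≢ j → R β s t → R (raise β j) s t
    kept-R s≢j t≢j r
      rewrite lookup-raise-≢ β s≢j | lookup-raise-≢ β t≢j = r
    kept : ∀ T → (∀ {s} → s ∈ T → s ∈ S) → AllPairs (R β) T → AllPairs (R (raise β j)) T
    kept []      T⊆S []       = []
    kept (s ∷ T) T⊆S (p ∷ ps) =
      All.tabulate (λ t∈ → kept-R (≢j (T⊆S (here ≡.refl))) (≢j (T⊆S (there t∈))) (All.lookup p t∈))
      ∷ kept T (T⊆S ∘ there) ps
    last : ∀ {s} → s ∈ S → R (raise β j) s j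
    last {s} s∈ rewrite lookup-raise-≢ β (≢j s∈) | lookup∘updateAt j {f = suc} β =
      let j-s , s-j = All.lookup (AllPairs.head (cyclic o)) s∈ in s-j , Before-suc j-s
    free′ : ∀ {f s} → f ∉ (S ++ j ∷ []) → s ∈ (S ++ j ∷ []) →
            Before (lookup (raise β j) f) f (lookup (raise β j) s) s
    free′ {f} {s} f∉ s∈
      rewrite lookup-raise-≢ β {j} {f} (λ e → f∉ (∈-++⁺ʳ S (here e))) =
      Before-mono (lookup-raise-≤ β j s) (free o f∉′ (s∈′ (∈-++⁻ S s∈)))
      where
      f∉′ : f ∉ (j ∷ S)
      f∉′ (here e)  = f∉ (∈-++⁺ʳ S (here e))
      f∉′ (there i) = f∉ (∈-++⁺ˡ i)
      s∈′ : s ∈ S ⊎ s ∈ (j ∷ []) → s ∈ (j ∷ S)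
      s∈′ (inj₁ i)        = there i
      s∈′ (inj₂ (here e)) = here e

  module _ {γ : Comp n} (o : Sorted (j ∷ S) β) (γ≥ : Above (j ∷ S) β γ) where
    open DecMembership (Fin._≟_ {n}) using (_∈?_)

    posγ-above-≤ : posγ γ j ℕ.≤ posγ β j
    posγ-above-≤ = posγ-≤ β γ j sub
      where
      sub : ∀ k → Before (lookup γ j) j (lookup γ k) k → Before (lookup β j) j (lookup β k) k
      sub k before with k ∈? (j ∷ S)
      ... | yes (here ≡.refl) = contradiction before (Before-irrefl {a = lookup γ j} {i = j})
      ... | yes (there k∈)    = proj₁ (All.lookup (AllPairs.head (cyclic o)) k∈)
      ... | no  k∉ rewrite frozen γ≥ k k∉ =
        contradiction (Before-mono (lower γ≥ j) (free o k∉ (here ≡.refl))) (Before-asym before)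

    -- Conversely, while the entry at `j` stays put, a coordinate that precedes `j` still does so
    -- after growing.
    posγ-above-≡ : lookup γ j ≡ lookup β j → posγ γ j ≡ posγ β j
    posγ-above-≡ γj≡βj = ℕ.≤-antisym posγ-above-≤ (posγ-≤ γ β j λ k before →
      ≡.subst (λ a → Before a j (lookup γ k) k) (≡.sym γj≡βj) (Before-mono (lower γ≥ k) before))

-- At the zero composition only the index breaks ties, so the last place belongs to the largest
-- index.
descending : ∀ n → List (Fin n)
descending n = L.tabulate Fin.opposite

∈-descending : ∀ {n} (i : Fin n) → i ∈ descending n
∈-descending i = ≡.subst (_∈ descending _) (Fin.opposite-involutive i) (∈-tabulate⁺ {f = Fin.opposite} (Fin.opposite i))

Sorted-descending : ∀ n → Sorted (descending n) (V.replicate n 0)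
Sorted-descending n = record
  { cyclic = AllPairs.tabulate⁺-< λ {i} {k} i<k → zeros (opposite-< i<k)
  ; free   = λ {f} f∉ _ → contradiction (∈-descending f) f∉ }
  where
  opposite-< : ∀ {i k : Fin n} → i Fin.< k → Fin.opposite k Fin.< Fin.opposite i
  opposite-< {i} {k} i<k = ≡.subst₂ ℕ._<_ (≡.sym (Fin.opposite-prop k)) (≡.sym (Fin.opposite-prop i))
    (ℕ.∸-monoʳ-< (ℕ.s≤s i<k) (Fin.toℕ<n k))
  zeros : ∀ {s t : Fin n} → t Fin.< s →
    Before (lookup (V.replicate n 0) s) s (lookup (V.replicate n 0) t) t
    × Before (lookup (V.replicate n 0) t) t (suc (lookup (V.replicate n 0) s)) s
  zeros {s} {t} t<s rewrite lookup-replicate s 0 | lookup-replicate t 0 =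
    inj₂ (t<s , ≡.refl) , inj₁ (ℕ.s≤s ℕ.z≤n)

-- The polynomial ring ℚ[r]

infix 4 _≋_
-- `_≈P_` unfolds to a function type from which the two polynomials cannot be inferred; the record
-- keeps them visible to unification.
record _≋_ (p q : QPoly) : Set where
  constructor coeffwise
  field at : p ≈P q
open _≋_

≋-refl : ∀ {p} → p ≋ p
≋-refl = coeffwise λ _ → ≡.refl

≋-sym : ∀ {p q} → p ≋ q → q ≋ p
≋-sym e = coeffwise λ k → ≡.sym (at e k)

≋-trans : ∀ {p q s} → p ≋ q → q ≋ s → p ≋ s
≋-trans e f = coeffwise λ k → ≡.trans (at e k) (at f k)

coeffQ-+P : ∀ p q k → coeffQ (p +P q) k ≡ coeffQ p k Q.+ coeffQ q k
coeffQ-+P []      q       k       = ≡.sym (Q.+-identityˡ _)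
coeffQ-+P (a ∷ p) []      k       = ≡.sym (Q.+-identityʳ _)
coeffQ-+P (a ∷ p) (b ∷ q) zero    = ≡.refl
coeffQ-+P (a ∷ p) (b ∷ q) (suc k) = coeffQ-+P p q k

coeffQ-map* : ∀ a q k → coeffQ (map (a Q.*_) q) k ≡ a Q.* coeffQ q k
coeffQ-map* a []      k       = ≡.sym (Q.*-zeroʳ a)
coeffQ-map* a (b ∷ q) zero    = ≡.refl
coeffQ-map* a (b ∷ q) (suc k) = coeffQ-map* a q k

coeffQ-negP : ∀ q k → coeffQ (negP q) k ≡ Q.- coeffQ q k
coeffQ-negP []      k       = ≡.refl
coeffQ-negP (b ∷ q) zero    = ≡.refl
coeffQ-negP (b ∷ q) (suc k) = coeffQ-negP q k

+P-cong : ∀ {p p′ q q′} → p ≋ p′ → q ≋ q′ → (p +P q) ≋ (p′ +P q′)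
+P-cong {p} {p′} {q} {q′} e f = coeffwise λ k →
  ≡.trans (coeffQ-+P p q k)
  (≡.trans (≡.cong₂ Q._+_ (at e k) (at f k)) (≡.sym (coeffQ-+P p′ q′ k)))

+P-comm : ∀ p q → (p +P q) ≋ (q +P p)
+P-comm p q = coeffwise λ k →
  ≡.trans (coeffQ-+P p q k)
  (≡.trans (Q.+-comm (coeffQ p k) (coeffQ q k)) (≡.sym (coeffQ-+P q p k)))

+P-assoc : ∀ p q s → ((p +P q) +P s) ≋ (p +P (q +P s))
+P-assoc p q s = coeffwise λ k →
  ≡.trans (coeffQ-+P (p +P q) s k)
  (≡.trans (≡.cong (Q._+ coeffQ s k) (coeffQ-+P p q k))
  (≡.trans (Q.+-assoc (coeffQ p k) (coeffQ q k) (coeffQ s k))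
  (≡.trans (≡.cong (coeffQ p k Q.+_) (≡.sym (coeffQ-+P q s k)))
         (≡.sym (coeffQ-+P p (q +P s) k)))))

+P-identityʳ : ∀ p → (p +P []) ≋ p
+P-identityʳ []      = ≋-refl
+P-identityʳ (a ∷ p) = ≋-refl

negP-cong : ∀ {p q} → p ≋ q → negP p ≋ negP q
negP-cong {p} {q} e = coeffwise λ k →
  ≡.trans (coeffQ-negP p k) (≡.trans (≡.cong Q.-_ (at e k)) (≡.sym (coeffQ-negP q k)))

negP-inverseʳ : ∀ p → (p +P negP p) ≋ []
negP-inverseʳ p = coeffwise λ k →
  ≡.trans (coeffQ-+P p (negP p) k)
  (≡.trans (≡.cong (coeffQ p k Q.+_) (coeffQ-negP p k)) (Q.+-inverseʳ (coeffQ p k)))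

∷-cong : ∀ {a b p q} → a ≡ b → p ≋ q → (a ∷ p) ≋ (b ∷ q)
∷-cong e f = coeffwise λ { zero → e ; (suc k) → at f k }

∷-injʳ : ∀ {a b p q} → (a ∷ p) ≋ (b ∷ q) → p ≋ q
∷-injʳ e = coeffwise λ k → at e (suc k)

0∷≋[] : ∀ {p} → p ≋ [] → (0ℚ ∷ p) ≋ []
0∷≋[] f = coeffwise λ { zero → ≡.refl ; (suc k) → at f k }

infixl 8 _·_
_·_ : ℚ → QPoly → QPoly
a · p = map (a Q.*_) p

·-cong : ∀ a {p q} → p ≋ q → a · p ≋ a · q
·-cong a {p} {q} e = coeffwise λ k →
  ≡.trans (coeffQ-map* a p k) (≡.trans (≡.cong (a Q.*_) (at e k)) (≡.sym (coeffQ-map* a q k)))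

·-+P : ∀ a p q → a · (p +P q) ≋ ((a · p) +P (a · q))
·-+P a p q = coeffwise λ k →
  ≡.trans (coeffQ-map* a (p +P q) k)
  (≡.trans (≡.cong (a Q.*_) (coeffQ-+P p q k))
  (≡.trans (Q.*-distribˡ-+ a (coeffQ p k) (coeffQ q k))
  (≡.trans (≡.cong₂ Q._+_ (≡.sym (coeffQ-map* a p k)) (≡.sym (coeffQ-map* a q k)))
         (≡.sym (coeffQ-+P (a · p) (a · q) k)))))

·-· : ∀ a b p → a · (b · p) ≋ (a Q.* b) · p
·-· a b p = coeffwise λ k →
  ≡.trans (coeffQ-map* a (b · p) k)
  (≡.trans (≡.cong (a Q.*_) (coeffQ-map* b p k))
  (≡.trans (≡.sym (Q.*-assoc a b (coeffQ p k))) (≡.sym (coeffQ-map* (a Q.* b) p k))))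

0· : ∀ p → 0ℚ · p ≋ []
0· p = coeffwise λ k → ≡.trans (coeffQ-map* 0ℚ p k) (Q.*-zeroˡ (coeffQ p k))

1· : ∀ p → 1ℚ · p ≋ p
1· p = coeffwise λ k → ≡.trans (coeffQ-map* 1ℚ p k) (Q.*-identityˡ (coeffQ p k))

+P-swap : ∀ p q s → (p +P (q +P s)) ≋ (q +P (p +P s))
+P-swap p q s =
  ≋-trans (≋-sym (+P-assoc p q s))
  (≋-trans (+P-cong {q = s} (+P-comm p q) ≋-refl) (+P-assoc q p s))

*P-zeroʳ : ∀ p → (p *P []) ≋ []
*P-zeroʳ []      = ≋-refl
*P-zeroʳ (a ∷ p) = 0∷≋[] (*P-zeroʳ p)

*P-congʳ : ∀ p {q q′} → q ≋ q′ → (p *P q) ≋ (p *P q′)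
*P-congʳ []      e = ≋-refl
*P-congʳ (a ∷ p) e = +P-cong (·-cong a e) (∷-cong ≡.refl (*P-congʳ p e))

-- `_*P_` recurses on its left factor; commutativity needs the matching recursion on the right one.
*P-∷ : ∀ p b q → (p *P (b ∷ q)) ≋ ((b · p) +P (0ℚ ∷ (p *P q)))
*P-∷ []      b q = ≋-sym (0∷≋[] ≋-refl)
*P-∷ (a ∷ p) b q = ∷-cong (≡.cong (Q._+ 0ℚ) (Q.*-comm a b))
  (≋-trans (+P-cong {p = a · q} ≋-refl (*P-∷ p b q))
           (+P-swap (a · q) (b · p) (0ℚ ∷ (p *P q))))

*P-comm : ∀ p q → (p *P q) ≋ (q *P p)
*P-comm []      q = ≋-sym (*P-zeroʳ q)
*P-comm (a ∷ p) q = ≋-trans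
  (+P-cong {p = a · q} ≋-refl (∷-cong ≡.refl (*P-comm p q))) (≋-sym (*P-∷ q a p))

*P-cong : ∀ {p p′ q q′} → p ≋ p′ → q ≋ q′ → (p *P q) ≋ (p′ *P q′)
*P-cong {p} {p′} {q} {q′} e f = ≋-trans (*P-congʳ p f)
  (≋-trans (*P-comm p q′) (≋-trans (*P-congʳ q′ e) (*P-comm q′ p′)))

*P-distribˡ : ∀ p q s → (p *P (q +P s)) ≋ ((p *P q) +P (p *P s))
*P-distribˡ []      q s = ≋-refl
*P-distribˡ (a ∷ p) q s =
  ≋-trans (+P-cong (·-+P a q s) (∷-cong ≡.refl (*P-distribˡ p q s)))
  (≋-trans (+P-assoc (a · q) (a · s) (0ℚ ∷ ((p *P q) +P (p *P s))))
  (≋-trans (+P-cong {p = a · q} ≋-refl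
     (+P-swap (a · s) (0ℚ ∷ (p *P q)) (0ℚ ∷ (p *P s))))
     (≋-sym (+P-assoc (a · q) (0ℚ ∷ (p *P q)) ((a · s) +P (0ℚ ∷ (p *P s)))))))

*P-distribʳ : ∀ p q s → ((q +P s) *P p) ≋ ((q *P p) +P (s *P p))
*P-distribʳ p q s = ≋-trans (*P-comm (q +P s) p)
  (≋-trans (*P-distribˡ p q s) (+P-cong (*P-comm p q) (*P-comm p s)))

·-*P : ∀ a p q → ((a · p) *P q) ≋ a · (p *P q)
·-*P a []      q = ≋-refl
·-*P a (b ∷ p) q =
  ≋-trans (+P-cong (≋-sym (·-· a b q)) (∷-cong (≡.sym (Q.*-zeroʳ a)) (·-*P a p q)))
          (≋-sym (·-+P a (b · q) (0ℚ ∷ (p *P q))))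

0∷-*P : ∀ p q → ((0ℚ ∷ p) *P q) ≋ (0ℚ ∷ (p *P q))
0∷-*P p q = +P-cong {q = 0ℚ ∷ (p *P q)} (0· q) ≋-refl

*P-assoc : ∀ p q s → ((p *P q) *P s) ≋ (p *P (q *P s))
*P-assoc []      q s = ≋-refl
*P-assoc (a ∷ p) q s =
  ≋-trans (*P-distribʳ s (a · q) (0ℚ ∷ (p *P q)))
          (+P-cong (·-*P a q s)
            (≋-trans (0∷-*P (p *P q) s) (∷-cong ≡.refl (*P-assoc p q s))))

*P-identityˡ : ∀ p → ((1ℚ ∷ []) *P p) ≋ p
*P-identityˡ p = ≋-trans (+P-cong (1· p) (0∷≋[] ≋-refl)) (+P-identityʳ p)

ℚ[r] : CommutativeRing 0ℓ 0ℓ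
ℚ[r] = record
  { Carrier = QPoly ; _≈_ = _≋_ ; _+_ = _+P_ ; _*_ = _*P_ ; -_ = negP
  ; 0# = [] ; 1# = 1ℚ ∷ []
  ; isCommutativeRing = record
    { isRing = record
      { +-isAbelianGroup = record
        { isGroup = record
          { isMonoid = record
            { isSemigroup = record
              { isMagma = record
                { isEquivalence = record { refl = ≋-refl ; sym = ≋-sym ; trans = ≋-trans }
                ; ∙-cong = +P-cong }
              ; assoc = +P-assoc }
            ; identity = (λ _ → ≋-refl) , +P-identityʳ }
          ; inverse = (λ p → ≋-trans (+P-comm (negP p) p) (negP-inverseʳ p)) , negP-inverseʳ
          ; ⁻¹-cong = negP-cong }
        ; comm = +P-comm }
      ; *-cong = *P-cong
      ; *-assoc = *P-assoc
      ; *-identity = *P-identityˡ ,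
          (λ p → ≋-trans (*P-comm p (1ℚ ∷ [])) (*P-identityˡ p))
      ; distrib = *P-distribˡ , *P-distribʳ
      }
    ; *-comm = *P-comm } }

coeffQ-0*P : ∀ a p b q → coeffQ ((a ∷ p) *P (b ∷ q)) 0 ≡ a Q.* b
coeffQ-0*P a p b q = Q.+-identityʳ (a Q.* b)

ℚ-integral : ∀ a b → a Q.* b ≡ 0ℚ → a ≡ 0ℚ ⊎ b ≡ 0ℚ
ℚ-integral a b e with a Q.≟ 0ℚ
... | yes a≡0 = inj₁ a≡0
... | no  a≢0 = inj₂ (≡.trans (≡.sym (Q.*-identityˡ b))
  (≡.trans (≡.cong (Q._* b) (≡.sym (Q.*-inverseˡ a)))
  (≡.trans (Q.*-assoc (Q.1/ a) a b) (≡.trans (≡.cong (Q.1/ a Q.*_) e) (Q.*-zeroʳ (Q.1/ a))))))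
  where instance _ = Q.≢-nonZero a≢0

*P-strip : ∀ {a} p q → a ≡ 0ℚ → ((a ∷ p) *P q) ≋ [] → (p *P q) ≋ []
*P-strip p q ≡.refl e = ∷-injʳ (≋-trans (≋-sym (0∷-*P p q)) (≋-trans e (≋-sym (0∷≋[] ≋-refl))))

-- The product of the lowest coefficients decides; a vanishing lowest coefficient is a factor r.
ℚ[r]-integral : ∀ p q → (p *P q) ≋ [] → p ≋ [] ⊎ q ≋ []
ℚ[r]-integral []      q       e = inj₁ ≋-refl
ℚ[r]-integral (a ∷ p) []      e = inj₂ ≋-refl
ℚ[r]-integral (a ∷ p) (b ∷ q) e =
  [ (λ a≡0 → Sum.map₁ (λ p≋0 → ≋-trans (∷-cong a≡0 p≋0) (0∷≋[] ≋-refl))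
      (ℚ[r]-integral p (b ∷ q) (*P-strip p (b ∷ q) a≡0 e)))
  , (λ b≡0 → Sum.map₂ (λ q≋0 → ≋-trans (∷-cong b≡0 q≋0) (0∷≋[] ≋-refl))
      (ℚ[r]-integral (a ∷ p) q (≋-trans (*P-comm (a ∷ p) q)
        (*P-strip q (a ∷ p) b≡0 (≋-trans (*P-comm (b ∷ q) (a ∷ p)) e)))))
  ]′ (ℚ-integral a b (≡.trans (≡.sym (coeffQ-0*P a p b q)) (at e 0)))

-- The field ℚ(r)

module CrossMultiplication {c ℓ} (D : CommutativeRing c ℓ) where
  open CommutativeRing D
  open SemiringSolver commutativeSemiring using (solve; _:=_; _:+_; _:*_)
  open SetoidReasoning setoid
  open RingProperties ring using (-‿distribˡ-*)

  -- The chain closes only up to the middle denominator `d₂`; cancelling it is where validity and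
  -- integrality enter.
  ×-trans : ∀ n₁ d₁ n₂ d₂ n₃ d₃ → n₁ * d₂ ≈ n₂ * d₁ → n₂ * d₃ ≈ n₃ * d₂ →
            d₂ * (n₁ * d₃) ≈ d₂ * (n₃ * d₁)
  ×-trans n₁ d₁ n₂ d₂ n₃ d₃ e f = begin
    d₂ * (n₁ * d₃)  ≈⟨ solve 3 (λ n₁ d₂ d₃ → d₂ :* (n₁ :* d₃) := (n₁ :* d₂) :* d₃) refl n₁ d₂ d₃ ⟩
    (n₁ * d₂) * d₃  ≈⟨ *-congʳ e ⟩
    (n₂ * d₁) * d₃  ≈⟨ solve 3 (λ n₂ d₁ d₃ → (n₂ :* d₁) :* d₃ := (n₂ :* d₃) :* d₁) refl n₂ d₁ d₃ ⟩
    (n₂ * d₃) * d₁  ≈⟨ *-congʳ f ⟩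
    (n₃ * d₂) * d₁  ≈⟨ solve 3 (λ n₃ d₁ d₂ → (n₃ :* d₂) :* d₁ := d₂ :* (n₃ :* d₁)) refl n₃ d₁ d₂ ⟩
    d₂ * (n₃ * d₁)  ∎

  ×-+-cong : ∀ n₁ d₁ m₁ e₁ n₂ d₂ m₂ e₂ → n₁ * e₁ ≈ m₁ * d₁ → n₂ * e₂ ≈ m₂ * d₂ →
             (n₁ * d₂ + n₂ * d₁) * (e₁ * e₂) ≈ (m₁ * e₂ + m₂ * e₁) * (d₁ * d₂)
  ×-+-cong n₁ d₁ m₁ e₁ n₂ d₂ m₂ e₂ p q = begin
    (n₁ * d₂ + n₂ * d₁) * (e₁ * e₂)
      ≈⟨ solve 6 (λ n₁ d₁ e₁ n₂ d₂ e₂ → (n₁ :* d₂ :+ n₂ :* d₁) :* (e₁ :* e₂)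
           := (n₁ :* e₁) :* (d₂ :* e₂) :+ (n₂ :* e₂) :* (d₁ :* e₁)) refl n₁ d₁ e₁ n₂ d₂ e₂ ⟩
    (n₁ * e₁) * (d₂ * e₂) + (n₂ * e₂) * (d₁ * e₁)
      ≈⟨ +-cong (*-congʳ p) (*-congʳ q) ⟩
    (m₁ * d₁) * (d₂ * e₂) + (m₂ * d₂) * (d₁ * e₁)
      ≈⟨ solve 6 (λ m₁ d₁ e₁ m₂ d₂ e₂ → (m₁ :* d₁) :* (d₂ :* e₂) :+ (m₂ :* d₂) :* (d₁ :* e₁)
           := (m₁ :* e₂ :+ m₂ :* e₁) :* (d₁ :* d₂)) refl m₁ d₁ e₁ m₂ d₂ e₂ ⟩
    (m₁ * e₂ + m₂ * e₁) * (d₁ * d₂) ∎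

  ×-*-cong : ∀ n₁ d₁ m₁ e₁ n₂ d₂ m₂ e₂ → n₁ * e₁ ≈ m₁ * d₁ → n₂ * e₂ ≈ m₂ * d₂ →
             (n₁ * n₂) * (e₁ * e₂) ≈ (m₁ * m₂) * (d₁ * d₂)
  ×-*-cong n₁ d₁ m₁ e₁ n₂ d₂ m₂ e₂ p q = begin
    (n₁ * n₂) * (e₁ * e₂)  ≈⟨ solve 4 (λ a b c d → (a :* b) :* (c :* d) := (a :* c) :* (b :* d)) refl n₁ n₂ e₁ e₂ ⟩
    (n₁ * e₁) * (n₂ * e₂)  ≈⟨ *-cong p q ⟩
    (m₁ * d₁) * (m₂ * d₂)  ≈⟨ solve 4 (λ a b c d → (a :* b) :* (c :* d) := (a :* c) :* (b :* d)) refl m₁ d₁ m₂ d₂ ⟩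
    (m₁ * m₂) * (d₁ * d₂)  ∎

  ×-neg-cong : ∀ n₁ d₁ n₂ d₂ → n₁ * d₂ ≈ n₂ * d₁ → (- n₁) * d₂ ≈ (- n₂) * d₁
  ×-neg-cong n₁ d₁ n₂ d₂ e =
    trans (sym (-‿distribˡ-* n₁ d₂)) (trans (-‿cong e) (-‿distribˡ-* n₂ d₁))

  ×-+-assoc : ∀ n₁ d₁ n₂ d₂ n₃ d₃ →
    ((n₁ * d₂ + n₂ * d₁) * d₃ + n₃ * (d₁ * d₂)) * (d₁ * (d₂ * d₃))
    ≈ (n₁ * (d₂ * d₃) + (n₂ * d₃ + n₃ * d₂) * d₁) * ((d₁ * d₂) * d₃)
  ×-+-assoc = solve 6 (λ n₁ d₁ n₂ d₂ n₃ d₃ →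
    ((n₁ :* d₂ :+ n₂ :* d₁) :* d₃ :+ n₃ :* (d₁ :* d₂)) :* (d₁ :* (d₂ :* d₃))
    := (n₁ :* (d₂ :* d₃) :+ (n₂ :* d₃ :+ n₃ :* d₂) :* d₁) :* ((d₁ :* d₂) :* d₃)) refl

  ×-+-comm : ∀ n₁ d₁ n₂ d₂ →
    (n₁ * d₂ + n₂ * d₁) * (d₂ * d₁) ≈ (n₂ * d₁ + n₁ * d₂) * (d₁ * d₂)
  ×-+-comm = solve 4 (λ n₁ d₁ n₂ d₂ →
    (n₁ :* d₂ :+ n₂ :* d₁) :* (d₂ :* d₁) := (n₂ :* d₁ :+ n₁ :* d₂) :* (d₁ :* d₂)) refl

  -- `z` stands for the numerator `0ℚ ∷ []` of `0F`, which agrees with the zero `[]` of the ring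
  -- only up to trailing zeros.
  ×-+-identityˡ : ∀ {z} n d → z ≈ 0# → (z * d + n * 1#) * d ≈ n * (1# * d)
  ×-+-identityˡ {z} n d z≈0 = begin
    (z * d + n * 1#) * d  ≈⟨ *-congʳ (+-cong (trans (*-congʳ z≈0) (zeroˡ d)) (*-identityʳ n)) ⟩
    (0# + n) * d          ≈⟨ *-cong (+-identityˡ n) (sym (*-identityˡ d)) ⟩
    n * (1# * d)          ∎

  ×-inverseˡ : ∀ {z} n d → z ≈ 0# → ((- n) * d + n * d) * 1# ≈ z * (d * d)
  ×-inverseˡ {z} n d z≈0 = begin
    ((- n) * d + n * d) * 1#  ≈⟨ *-identityʳ _ ⟩
    (- n) * d + n * d         ≈⟨ distribʳ d (- n) n ⟨
    (- n + n) * d             ≈⟨ *-congʳ (-‿inverseˡ n) ⟩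
    0# * d                    ≈⟨ zeroˡ d ⟩
    0#                        ≈⟨ zeroˡ (d * d) ⟨
    0# * (d * d)              ≈⟨ *-congʳ z≈0 ⟨
    z * (d * d)               ∎

  ×-*-assoc : ∀ n₁ d₁ n₂ d₂ n₃ d₃ →
    ((n₁ * n₂) * n₃) * (d₁ * (d₂ * d₃)) ≈ (n₁ * (n₂ * n₃)) * ((d₁ * d₂) * d₃)
  ×-*-assoc n₁ d₁ n₂ d₂ n₃ d₃ = *-cong (*-assoc n₁ n₂ n₃) (sym (*-assoc d₁ d₂ d₃))

  ×-*-comm : ∀ n₁ d₁ n₂ d₂ → (n₁ * n₂) * (d₂ * d₁) ≈ (n₂ * n₁) * (d₁ * d₂)
  ×-*-comm n₁ d₁ n₂ d₂ = *-cong (*-comm n₁ n₂) (*-comm d₂ d₁)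

  ×-distribˡ : ∀ n₁ d₁ n₂ d₂ n₃ d₃ →
    (n₁ * (n₂ * d₃ + n₃ * d₂)) * ((d₁ * d₂) * (d₁ * d₃))
    ≈ ((n₁ * n₂) * (d₁ * d₃) + (n₁ * n₃) * (d₁ * d₂)) * (d₁ * (d₂ * d₃))
  ×-distribˡ = solve 6 (λ n₁ d₁ n₂ d₂ n₃ d₃ →
    (n₁ :* (n₂ :* d₃ :+ n₃ :* d₂)) :* ((d₁ :* d₂) :* (d₁ :* d₃))
    := ((n₁ :* n₂) :* (d₁ :* d₃) :+ (n₁ :* n₃) :* (d₁ :* d₂)) :* (d₁ :* (d₂ :* d₃))) refl

open CrossMultiplication ℚ[r]
module ℚ[r]-ring = CommutativeRing ℚ[r]

-- Fractions with nonzero denominator, as a commutative ring.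

record K : Set where
  constructor _,_
  field
    val   : 𝔽
    valid : Valid val
open K

infix 4 _≈K_
record _≈K_ (a b : K) : Set where
  constructor cross
  field eq : (num (val a) *P den (val b)) ≋ (num (val b) *P den (val a))
open _≈K_

≈K⇒≈F : ∀ {a b} → a ≈K b → val a ≈F val b
≈K⇒≈F e = _≋_.at (eq e)

≈F⇒≈K : ∀ {a b} → val a ≈F val b → a ≈K b
≈F⇒≈K e = cross (coeffwise e)

*P-nonzero : ∀ p q → ¬ (p ≈P []) → ¬ (q ≈P []) → ¬ ((p *P q) ≈P [])
*P-nonzero p q p≉0 q≉0 pq≈0 with ℚ[r]-integral p q (coeffwise pq≈0)
... | inj₁ p≋0 = p≉0 (_≋_.at p≋0)
... | inj₂ q≋0 = q≉0 (_≋_.at q≋0)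

*P-cancelˡ : ∀ p {q s} → ¬ (p ≈P []) → (p *P q) ≋ (p *P s) → q ≋ s
*P-cancelˡ p {q} {s} p≉0 e with ℚ[r]-integral p (q ℚ[r]-ring.- s) p[q-s]≋0
  where
  open RingProperties ℚ[r]-ring.ring
  p[q-s]≋0 : (p *P (q ℚ[r]-ring.- s)) ≋ []
  p[q-s]≋0 = ≋-trans (*P-distribˡ p q (negP s))
    (≋-trans (+P-cong e (≋-sym (-‿distribʳ-* p s))) (negP-inverseʳ (p *P s)))
... | inj₁ p≋0 with () ← p≉0 (_≋_.at p≋0)
... | inj₂ q-s≋0 = RingProperties.x∙y⁻¹≈ε⇒x≈y ℚ[r]-ring.ring q s q-s≋0

1≉0 : ¬ ((1ℚ ∷ []) ≈P [])
1≉0 e with () ← e 0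

infixl 6 _+K_
infixl 7 _*K_
_+K_ _*K_ : K → K → K
(a , va) +K (b , vb) = (a +F b) , *P-nonzero (den a) (den b) va vb
(a , va) *K (b , vb) = (a *F b) , *P-nonzero (den a) (den b) va vb

-K_ : K → K
-K (a , va) = (-F a) , va

0K 1K : K
0K = 0F , 1≉0
1K = 1F , 1≉0

[0]≋0 : (0ℚ ∷ []) ≋ []
[0]≋0 = 0∷≋[] ≋-refl

≈K-trans : ∀ {a b c} → a ≈K b → b ≈K c → a ≈K c
≈K-trans {a , _} {b , vb} {c , _} (cross e) (cross f) = cross (*P-cancelˡ (den b) vb
  (×-trans (num a) (den a) (num b) (den b) (num c) (den c) e f))

+K-comm : ∀ a b → a +K b ≈K b +K a
+K-comm (a , _) (b , _) = cross (×-+-comm (num a) (den a) (num b) (den b))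

*K-comm : ∀ a b → a *K b ≈K b *K a
*K-comm (a , _) (b , _) = cross (×-*-comm (num a) (den a) (num b) (den b))

+K-identityˡ : ∀ a → 0K +K a ≈K a
+K-identityˡ (a , _) = cross (×-+-identityˡ (num a) (den a) [0]≋0)

-K-inverseˡ : ∀ a → (-K a) +K a ≈K 0K
-K-inverseˡ (a , _) = cross (×-inverseˡ (num a) (den a) [0]≋0)

*K-identityˡ : ∀ a → 1K *K a ≈K a
*K-identityˡ (a , _) = cross (≋-trans (*P-cong (*P-identityˡ (num a)) ≋-refl)
  (*P-congʳ (num a) (≋-sym (*P-identityˡ (den a)))))

+K-cong : ∀ {a b c d} → a ≈K b → c ≈K d → a +K c ≈K b +K d
+K-cong {a , _} {b , _} {c , _} {d , _} (cross e) (cross f) = cross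
  (×-+-cong (num a) (den a) (num b) (den b) (num c) (den c) (num d) (den d) e f)

*K-cong : ∀ {a b c d} → a ≈K b → c ≈K d → a *K c ≈K b *K d
*K-cong {a , _} {b , _} {c , _} {d , _} (cross e) (cross f) = cross
  (×-*-cong (num a) (den a) (num b) (den b) (num c) (den c) (num d) (den d) e f)

-K-cong : ∀ {a b} → a ≈K b → (-K a) ≈K (-K b)
-K-cong {a , _} {b , _} (cross e) =
  cross (×-neg-cong (num a) (den a) (num b) (den b) e)

*K-distribˡ : ∀ a b c → a *K (b +K c) ≈K a *K b +K a *K c
*K-distribˡ (a , _) (b , _) (c , _) =
  cross (×-distribˡ (num a) (den a) (num b) (den b) (num c) (den c))

K-commutativeRing : CommutativeRing 0ℓ 0ℓ
K-commutativeRing = record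
  { Carrier = K ; _≈_ = _≈K_ ; _+_ = _+K_ ; _*_ = _*K_ ; -_ = -K_ ; 0# = 0K ; 1# = 1K
  ; isCommutativeRing = record
    { isRing = record
      { +-isAbelianGroup = record
        { isGroup = record
          { isMonoid = record
            { isSemigroup = record
              { isMagma = record
                { isEquivalence = record
                  { refl = cross ≋-refl
                  ; sym = λ e → cross (≋-sym (eq e))
                  ; trans = ≈K-trans }
                ; ∙-cong = +K-cong }
              ; assoc = λ (a , _) (b , _) (c , _) →
                  cross (×-+-assoc (num a) (den a) (num b) (den b) (num c) (den c)) }
            ; identity = +K-identityˡ , λ a → ≈K-trans (+K-comm a 0K) (+K-identityˡ a) }
          ; inverse = -K-inverseˡ , λ a → ≈K-trans (+K-comm a (-K a)) (-K-inverseˡ a)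
          ; ⁻¹-cong = -K-cong }
        ; comm = +K-comm }
      ; *-cong = *K-cong
      ; *-assoc = λ (a , _) (b , _) (c , _) →
          cross (×-*-assoc (num a) (den a) (num b) (den b) (num c) (den c))
      ; *-identity = *K-identityˡ , λ a → ≈K-trans (*K-comm a 1K) (*K-identityˡ a)
      ; distrib = *K-distribˡ , λ a b c → ≈K-trans (*K-comm (b +K c) a)
          (≈K-trans (*K-distribˡ a b c) (+K-cong (*K-comm a b) (*K-comm a c))) }
    ; *-comm = *K-comm } }

invK : (a : K) → ¬ (num (val a) ≈P []) → K
invK (a , _) n≉0 = (den a / num a) , n≉0

*K-inverseʳ : ∀ a n≉0 → a *K invK a n≉0 ≈K 1K
*K-inverseʳ (a , _) n≉0 = cross (≋-trans (*P-comm (num a *P den a) (1ℚ ∷ []))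
  (*P-congʳ (1ℚ ∷ []) (*P-comm (num a) (den a))))

module 𝕂 = CommutativeRing K-commutativeRing
open Polynomials K-commutativeRing

-- Units among the elements of ℚ(r) that occur.

fromℕ : ℕ → ℚ
fromℕ k = ℤ.+ k Q./ 1

-- `Q._/_` reduces to lowest terms, so the two sides are compared as unnormalised fractions.
fromℕ-+ : ∀ k l → fromℕ (k ℕ.+ l) ≡ fromℕ k Q.+ fromℕ l
fromℕ-+ k l = Q.toℚᵘ-injective (begin
  Q.toℚᵘ (fromℕ (k ℕ.+ l))
    ≈⟨ Q.toℚᵘ-fromℚᵘ (Qᵘ.mkℚᵘ (ℤ.+ (k ℕ.+ l)) 0) ⟩
  Qᵘ.mkℚᵘ (ℤ.+ (k ℕ.+ l)) 0
    ≈⟨ Qᵘ.*≡* (≡.cong (ℤ._* ℤ.+ 1) (≡.sym (≡.cong₂ ℤ._+_ (ℤ.*-identityʳ (ℤ.+ k)) (ℤ.*-identityʳ (ℤ.+ l))))) ⟩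
  Qᵘ.mkℚᵘ (ℤ.+ k) 0 Qᵘ.+ Qᵘ.mkℚᵘ (ℤ.+ l) 0
    ≈⟨ Qᵘ.+-cong (Q.toℚᵘ-fromℚᵘ (Qᵘ.mkℚᵘ (ℤ.+ k) 0)) (Q.toℚᵘ-fromℚᵘ (Qᵘ.mkℚᵘ (ℤ.+ l) 0)) ⟨
  Q.toℚᵘ (fromℕ k) Qᵘ.+ Q.toℚᵘ (fromℕ l)
    ≈⟨ Q.toℚᵘ-homo-+ (fromℕ k) (fromℕ l) ⟨
  Q.toℚᵘ (fromℕ k Q.+ fromℕ l) ∎)
  where open SetoidReasoning Qᵘ.≃-setoid

fromℕ-suc≢0 : ∀ k → fromℕ (suc k) ≢ 0ℚ
fromℕ-suc≢0 k e with Q./-injective-≃ (Qᵘ.mkℚᵘ (ℤ.+ suc k) 0) Qᵘ.0ℚᵘ e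
... | Qᵘ.*≡* ()

coeffQ-*P-0 : ∀ p q → coeffQ (p *P q) 0 ≡ coeffQ p 0 Q.* coeffQ q 0
coeffQ-*P-0 []      q       = ≡.sym (Q.*-zeroˡ (coeffQ q 0))
coeffQ-*P-0 (a ∷ p) []      = ≡.sym (Q.*-zeroʳ a)
coeffQ-*P-0 (a ∷ p) (b ∷ q) = coeffQ-0*P a p b q

natK : ℕ → K
natK k = fromℕF k , 1≉0

rK αK : K
rK = rF , 1≉0
αK = αF , λ e → contradiction (e 1) λ ()

fromℚ-+ : ∀ a b {c} → c ≡ a Q.+ b → (fromℚ c , 1≉0) ≈K (fromℚ a , 1≉0) +K (fromℚ b , 1≉0)
fromℚ-+ a b {c} c≡a+b = cross (≋-trans (≋-trans (*P-congʳ (c ∷ []) (*1 (1ℚ ∷ []))) (≋-trans (*1 (c ∷ [])) (∷-cong c≡a+b ≋-refl)))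
  (≋-sym (≋-trans (*1 (((a ∷ []) *P (1ℚ ∷ [])) +P ((b ∷ []) *P (1ℚ ∷ []))))
    (+P-cong (*1 (a ∷ [])) (*1 (b ∷ []))))))
  where
  *1 : ∀ p → (p *P (1ℚ ∷ [])) ≋ p
  *1 p = ≋-trans (*P-comm p (1ℚ ∷ [])) (*P-identityˡ p)

natK-+ : ∀ k l → natK (k ℕ.+ l) ≈K natK k +K natK l
natK-+ k l = fromℚ-+ (fromℕ k) (fromℕ l) (fromℕ-+ k l)

-- The numerator of `rF` is the denominator of `αF`, so after cross-multiplication the two sides
-- differ only in bracketing.
αr≈1 : αK *K rK ≈K 1K
αr≈1 = cross (*P-assoc (1ℚ ∷ []) (0ℚ ∷ 1ℚ ∷ []) (1ℚ ∷ []))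

nonzero-Unit : ∀ a → coeffQ (num (val a)) 0 ≢ 0ℚ → Unit a
nonzero-Unit a a₀≢0 = invK a n≉0 , *K-inverseʳ a n≉0
  where
  n≉0 : ¬ (num (val a) ≈P [])
  n≉0 e = a₀≢0 (e 0)

-- At r = 0 the value is k + 1 ≠ 0.
suc+r*-Unit : ∀ k l → Unit (natK (suc k) +K rK *K natK l)
suc+r*-Unit k l = nonzero-Unit (natK (suc k) +K rK *K natK l)
  λ e → fromℕ-suc≢0 k (≡.trans (≡.sym (at-0 (fromℕ (suc k)) (fromℕ l))) e)
  where
  at-0 : ∀ s t → coeffQ (num (fromℚ s +F (rF *F fromℚ t))) 0 ≡ s
  at-0 s t = ≡.trans (coeffQ-+P ((s ∷ []) *P ((1ℚ ∷ []) *P (1ℚ ∷ [])))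
                        (((0ℚ ∷ 1ℚ ∷ []) *P (t ∷ [])) *P (1ℚ ∷ [])) 0)
    (≡.trans (≡.cong₂ Q._+_ (≡.trans (coeffQ-*P-0 (s ∷ []) ((1ℚ ∷ []) *P (1ℚ ∷ []))) (Q.*-identityʳ s))
      (≡.trans (coeffQ-*P-0 ((0ℚ ∷ 1ℚ ∷ []) *P (t ∷ [])) (1ℚ ∷ []))
        (≡.trans (≡.cong (Q._* 1ℚ) (≡.trans (coeffQ-*P-0 (0ℚ ∷ 1ℚ ∷ []) (t ∷ [])) (Q.*-zeroˡ t)))
          (Q.*-zeroˡ 1ℚ))))
      (Q.+-identityʳ s))

module AffineForms {c ℓ} (R : CommutativeRing c ℓ) where
  open CommutativeRing R
  open SetoidReasoning setoid
  open SemiringSolver commutativeSemiring using (solve; _:=_; _:+_; _:*_)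

  affine-difference : ∀ r {k′ k m l′ l j} → k′ ≈ k + m → l′ ≈ l + j →
    m + r * j ≈ (k′ + r * l′) - (k + r * l)
  affine-difference r {k′} {k} {m} {l′} {l} {j} k′≈ l′≈ = begin
    m + r * j
      ≈⟨ +-identityʳ _ ⟨
    (m + r * j) + 0#
      ≈⟨ +-congˡ (-‿inverseʳ (k + r * l)) ⟨
    (m + r * j) + ((k + r * l) - (k + r * l))
      ≈⟨ solve 6 (λ k m r l j b → (m :+ r :* j) :+ ((k :+ r :* l) :+ b)
           := ((k :+ m) :+ r :* (l :+ j)) :+ b) refl k m r l j (- (k + r * l)) ⟩
    ((k + m) + r * (l + j)) - (k + r * l)
      ≈⟨ +-congʳ (+-cong k′≈ (*-congˡ l′≈)) ⟨
    (k′ + r * l′) - (k + r * l) ∎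

  affine-inverse : ∀ {a r} s t → a * r ≈ 1# → a * (s + r * t) ≈ a * s + t
  affine-inverse {a} {r} s t ar≈1 = begin
    a * (s + r * t)        ≈⟨ solve 4 (λ a s r t → a :* (s :+ r :* t) := a :* s :+ (a :* r) :* t) refl a s r t ⟩
    a * s + (a * r) * t    ≈⟨ +-congˡ (trans (*-congʳ ar≈1) (*-identityˡ t)) ⟩
    a * s + t              ∎

open AffineForms K-commutativeRing

difference-Unit : ∀ {k k′ l l′} → k ℕ.< k′ → l ℕ.≤ l′ →
  Unit ((natK k′ +K rK *K natK l′) 𝕂.- (natK k +K rK *K natK l))
difference-Unit {k} {l = l} k<k′ l≤l′
  with m , ≡.refl ← ℕ.m≤n⇒∃[o]m+o≡n k<k′ | j , ≡.refl ← ℕ.m≤n⇒∃[o]m+o≡n l≤l′ =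
  Unit-resp (affine-difference rK {natK (suc (k ℕ.+ m))} {natK k} {natK (suc m)} {natK (l ℕ.+ j)} {natK l} {natK j}
      (≡.subst (λ k′ → natK k′ ≈K natK k +K natK (suc m)) (ℕ.+-suc k m) (natK-+ k (suc m)))
      (natK-+ l j))
    (suc+r*-Unit m j)

-- Such a factor of `dη` is α times k + 1 + r (l + 1), and α has the inverse `r`.
α*-Unit : ∀ k l → Unit (αK *K natK (suc k) +K natK (suc l))
α*-Unit k l = Unit-resp (affine-inverse {αK} {rK} (natK (suc k)) (natK (suc l)) αr≈1)
  (Unit-* {αK} {natK (suc k) +K rK *K natK (suc l)} (rK , αr≈1) (suc+r*-Unit k (suc l)))

-- `dη` is a product of raw fractions, so its validity has to be produced together with the inverse.
Invertible : 𝔽 → Set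
Invertible a = Σ (Valid a) λ v → Unit (a , v)

prodF-Invertible : ∀ {xs} → All Invertible xs → Invertible (prodF xs)
prodF-Invertible []             = 1≉0 , 1K , 𝕂.*-identityˡ 1K
prodF-Invertible {x ∷ xs} ((v , u) ∷ is) = with-tail (prodF-Invertible is)
  where
  with-tail : Invertible (prodF xs) → Invertible (x *F prodF xs)
  with-tail (w , z) = valid ((x , v) *K (prodF xs , w)) , Unit-* {x , v} {prodF xs , w} u z

dη-Invertible : ∀ {n} (γ : Comp n) → Invertible (dη γ)
dη-Invertible {n} γ = prodF-Invertible (All.concat⁺ (All.map⁺ (All.universal (λ i →
  All.map⁺ (All.universal (λ j →
    valid (αK *K natK (suc (armη γ i j)) +K natK (suc (legη γ i j))) , α*-Unit (armη γ i j) (legη γ i j)) _))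
  (allFin n))))

dK : ∀ {n} → Comp n → K
dK γ = dη γ , proj₁ (dη-Invertible γ)

dK-Unit : ∀ {n} (γ : Comp n) → Unit (dK γ)
dK-Unit γ = proj₂ (dη-Invertible γ)

-- The points γ̄ as interpolation nodes.

barK : ∀ {n} → Comp n → Vec K n
barK {n} γ = V.tabulate λ i → natK (lookup γ i) +K rK *K natK ((n ∸ 1) ∸ posγ γ i)

map-val-barK : ∀ {n} (γ : Comp n) → V.map val (barK γ) ≡ bar γ
map-val-barK γ = ≡.sym (tabulate-∘ val _)

barK-Nodes : ∀ {n} → Nodes {n} barK Sorted
barK-Nodes {n} = record
  { freeze = Sorted-freeze
  ; raised = Sorted-raise
  ; fresh  = Sorted-fresh
  ; flat   = λ {j} {S} {β} {γ} o γ≥ γj≡βj → 𝕂.reflexive (≡.trans (lookup∘tabulate _ j)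
      (≡.trans (≡.cong₂ (λ a p → natK a +K rK *K natK ((n ∸ 1) ∸ p)) γj≡βj (posγ-above-≡ o γ≥ γj≡βj))
        (≡.sym (lookup∘tabulate _ j))))
  -- A smaller `posγ` means a larger multiple `(n ∸ 1) ∸ posγ` of `r`, so both parts of the
  -- difference are natural numbers and the integer part is positive.
  ; steep  = λ {j} {S} {β} {γ} o γ≥ βj<γj → ≡.subst₂ (λ a b → Unit (a 𝕂.- b))
      (≡.sym (lookup∘tabulate _ j)) (≡.sym (lookup∘tabulate _ j))
      (difference-Unit βj<γj (ℕ.∸-monoʳ-≤ (n ∸ 1) (posγ-above-≤ o γ≥)))
  }

-- Transfer to the list representation over unrestricted fractions

module _ {n : ℕ} where
  open Newton (barK-Nodes {n}) using (ev)
  open Newton.Interpolation (barK-Nodes {n}) (Sorted-descending n) ∈-descending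
    using (Interpolates; degree; leading; vanish)
  open BarMonomials K-commutativeRing (barK-Nodes {n}) (Sorted-descending n) ∈-descending
    dK dK-Unit
    using (top; reflect; termTop; termBar; Σterm; Admissible; ev⁻; Characterised; monic; vanish⁻;
           characterised-unique; bar-characterised; mono-expansion; Summand)

  raw : Poly {n} → MPoly n
  raw = map λ (a , m) → (val a , m)

  raw-valid : ∀ p → ValidM (raw p)
  raw-valid []            = []
  raw-valid ((a , m) ∷ p) = valid a ∷ raw-valid p

  -- The equality holds on the nose, so statements about valid lists transfer by substitution.
  ValidM⇒raw : ∀ {p} → ValidM p → ∃ λ q → raw q ≡ p
  ValidM⇒raw []                          = [] , ≡.refl
  ValidM⇒raw {(a , m) ∷ _} (v ∷ vs) =
    let q , e = ValidM⇒raw vs in ((a , v) , m) ∷ q , ≡.cong ((a , m) ∷_) e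

  infix 4 _represents_
  -- `coeffM` skips a different monomial where `coeff` adds `a * 0#`. The two results agree only as
  -- fractions, so the validity of the raw one has to be carried along.
  record _represents_ (a : 𝔽) (b : K) : Set where
    constructor represent
    field
      {valid′} : Valid a
      equal    : (a , valid′) ≈K b

  represents-val : ∀ b → val b represents b
  represents-val b = represent {valid′ = valid b} (𝕂.refl {b})

  represents⇒≈F : ∀ {a b c d} → a represents c → b represents d → c ≈K d → a ≈F b
  represents⇒≈F (represent e) (represent f) c≈d = ≈K⇒≈F (≈K-trans e (≈K-trans c≈d (𝕂.sym f)))

  represents⇒≈K : ∀ {a b c d} → a represents c → b represents d → a ≈F b → c ≈K d
  represents⇒≈K (represent {va} e) (represent {vb} f) a≈b =
    ≈K-trans (𝕂.sym e) (≈K-trans (≈F⇒≈K {_ , va} {_ , vb} a≈b) f)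

  coeffM-represents : ∀ p m → coeffM (raw p) m represents coeff p m
  coeffM-represents []             m = represents-val 0K
  coeffM-represents ((a , m′) ∷ p) m with coeffM-represents p m
  ... | represent {v} e with ≡-dec ℕ._≟_ m′ m
  ...   | yes _ = represent {valid′ = valid (a +K (coeffM (raw p) m , v))}
                    (+K-cong {a} {a *K 1K} (𝕂.sym (𝕂.*-identityʳ a)) e)
  ...   | no  _ = represent {valid′ = v} (≈K-trans e (𝕂.sym (≈K-trans
                    (+K-cong {a *K 0K} (𝕂.zeroʳ a) (𝕂.refl {coeff p m})) (+K-identityˡ (coeff p m)))))

  val-^ : ∀ a k → val a ^F k ≡ val (a ^ k)
  val-^ a zero    = ≡.refl
  val-^ a (suc k) = ≡.cong (val a *F_) (val-^ a k)

  val-mon : ∀ {k} (m : Comp k) (v : Vec K k) → monoEval m (V.map val v) ≡ val (mon v m)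
  val-mon []      []      = ≡.refl
  val-mon (k ∷ m) (a ∷ v) = ≡.cong₂ _*F_ (val-^ a k) (val-mon m v)

  val-lin : ∀ (v : Vec K n) p → evalM (raw p) (V.map val v) ≡ val (lin (mon v) p)
  val-lin v []            = ≡.refl
  val-lin v ((a , m) ∷ p) = ≡.cong₂ _+F_ (≡.cong (val a *F_) (val-mon m v)) (val-lin v p)

  evalM-represents : ∀ p v {w} → V.map val v ≡ w → evalM (raw p) w represents lin (mon v) p
  evalM-represents p v ≡.refl = ≡.subst (_represents lin (mon v) p) (≡.sym (val-lin v p))
    (represents-val (lin (mon v) p))

  evalM-bar : ∀ p γ → evalM (raw p) (bar γ) represents ev γ p
  evalM-bar p γ = evalM-represents p (barK γ) (map-val-barK γ)

  evalM-negV-bar : ∀ p γ → evalM (raw p) (negV (bar γ)) represents ev⁻ γ p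
  evalM-negV-bar p γ = evalM-represents p (V.map -K_ (barK γ)) (≡.trans
    (≡.trans (≡.sym (V.map-∘ val -K_ (barK γ))) (V.map-∘ -F_ val (barK γ)))
    (≡.cong negV (map-val-barK γ)))

  raw-++ : ∀ p q → raw (p ++ q) ≡ raw p ++ raw q
  raw-++ = map-++ _

  raw-scale : ∀ a p → raw (scale a p) ≡ scaleM (val a) (raw p)
  raw-scale a []            = ≡.refl
  raw-scale a ((b , m) ∷ p) = ≡.cong (_ ∷_) (raw-scale a p)

  raw-reflect : ∀ p → raw (reflect p) ≡ negxM (raw p)
  raw-reflect []            = ≡.refl
  raw-reflect ((b , m) ∷ p) = ≡.cong₂ _∷_
    (≡.cong (λ s → s *F val b , m) (≡.sym (val-^ (-K 1K) ∣ m ∣))) (raw-reflect p)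

  raw-top : ∀ k p → raw (top k p) ≡ topM k (raw p)
  raw-top k []            = ≡.refl
  -- `ℕ.≟` computes through this boolean, so abstracting it reduces the filters on both sides.
  raw-top k ((b , m) ∷ p) with ∣ m ∣ ℕ.≡ᵇ k
  ... | true  = ≡.cong (_ ∷_) (raw-top k p)
  ... | false = raw-top k p

  rawT : Summand → Term n
  rawT (a , γ , E) = val a , γ , raw E

  raw-termTop : ∀ t → raw (termTop t) ≡ termα (rawT t)
  raw-termTop (a , γ , E) = ≡.trans (raw-scale a _) (≡.cong (scaleM (val a))
    (≡.trans (raw-scale (dK γ) _) (≡.cong (scaleM (dη γ)) (raw-top ∣ γ ∣ E))))

  raw-termBar : ∀ t → raw (termBar t) ≡ termrδ (rawT t)
  raw-termBar (a , γ , E) = ≡.trans (raw-scale a _) (≡.cong (scaleM (val a))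
    (≡.trans (raw-scale (sgn ∣ γ ∣ *K dK γ) _) (≡.cong₂ scaleM
      (≡.cong (_*F dη γ) (≡.sym (val-^ (-K 1K) ∣ γ ∣))) (raw-reflect E))))

  raw-Σterm : ∀ {f g} → (∀ t → raw (f t) ≡ g (rawT t)) → ∀ ts →
              raw (Σterm f ts) ≡ sumM (map g (map rawT ts))
  raw-Σterm f≡g []       = ≡.refl
  raw-Σterm {f} f≡g (t ∷ ts) =
    ≡.trans (raw-++ (f t) (Σterm f ts)) (≡.cong₂ _++_ (f≡g t) (raw-Σterm f≡g ts))

  Interpolates⇒IsE : ∀ γ E → Interpolates γ E → IsE γ (raw E)
  Interpolates⇒IsE γ E i =
    raw-valid E
    , (λ m γ<m → represents⇒≈F (coeffM-represents E m) (represents-val 0K) (degree i m γ<m))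
    , represents⇒≈F (coeffM-represents E γ) (represents-val 1K) (leading i)
    , (λ γ′ γ′≢γ γ′≤γ → represents⇒≈F (evalM-bar E γ′) (represents-val 0K) (vanish i γ′ γ′≢γ γ′≤γ))

  IsE⇒Interpolates : ∀ γ E → IsE γ (raw E) → Interpolates γ E
  IsE⇒Interpolates γ E (_ , deg , lead , van) = record
    { degree  = λ m γ<m → represents⇒≈K (coeffM-represents E m) (represents-val 0K) (deg m γ<m)
    ; leading = represents⇒≈K (coeffM-represents E γ) (represents-val 1K) lead
    ; vanish  = λ γ′ γ′≢γ γ′≤γ → represents⇒≈K (evalM-bar E γ′) (represents-val 0K) (van γ′ γ′≢γ γ′≤γ) }

  raw-difference : ∀ η g → raw (g ++ scale (-K 1K) (mono η)) ≡ raw g +M (-M monoM η)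
  raw-difference η g = ≡.trans (raw-++ g (scale (-K 1K) (mono η))) (≡.cong (raw g ++_) (raw-scale (-K 1K) (mono η)))

  Characterised⇒Cond : ∀ η g → Characterised η g → Cond η (raw g)
  Characterised⇒Cond η g C =
    (λ m η≤m → ≡.subst (λ p → coeffM p m ≈F 0F) (raw-difference η g)
      (represents⇒≈F (coeffM-represents (g ++ scale (-K 1K) (mono η)) m) (represents-val 0K) (monic C m η≤m)))
    , λ γ γ<η → represents⇒≈F (evalM-negV-bar g γ) (represents-val 0K) (vanish⁻ C γ γ<η)

  Cond⇒Characterised : ∀ η g → Cond η (raw g) → Characterised η g
  Cond⇒Characterised η g (deg , van) = record
    { monic   = λ m η≤m → represents⇒≈K (coeffM-represents (g ++ scale (-K 1K) (mono η)) m) (represents-val 0K)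
        (≡.subst (λ p → coeffM p m ≈F 0F) (≡.sym (raw-difference η g)) (deg m η≤m))
    ; vanish⁻ = λ γ γ<η → represents⇒≈K (evalM-negV-bar g γ) (represents-val 0K) (van γ γ<η) }

  coeffM-≈ : ∀ p q → (∀ m → coeff p m ≈K coeff q m) → raw p ≈M raw q
  coeffM-≈ p q p≈q m = represents⇒≈F (coeffM-represents p m) (coeffM-represents q m) (p≈q m)

  ≈M-coeff : ∀ p q → raw p ≈M raw q → ∀ m → coeff p m ≈K coeff q m
  ≈M-coeff p q p≈q m = represents⇒≈K (coeffM-represents p m) (coeffM-represents q m) (p≈q m)

  termOK⇒raw : ∀ {ts} → All termOK ts → ∃ λ ss → All Admissible ss × map rawT ss ≡ ts
  termOK⇒raw []                                                   = [] , [] , ≡.refl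
  termOK⇒raw {(a , γ , E) ∷ ts} ((v , isE@(validE , _)) ∷ oks) =
    let E′ , e = ValidM⇒raw validE ; ss , ok , f = termOK⇒raw oks in
    ((a , v) , γ , E′) ∷ ss
    , IsE⇒Interpolates γ E′ (≡.subst (IsE γ) (≡.sym e) isE) ∷ ok
    , ≡.cong₂ (λ E ts → (a , γ , E) ∷ ts) e f

  ≈M-refl : (p : MPoly n) → p ≈M p
  ≈M-refl p m k = ≡.refl

  Admissible⇒termOK : ∀ t → Admissible t → termOK (rawT t)
  Admissible⇒termOK (a , γ , E) i = valid a , Interpolates⇒IsE γ E i

  Admissibles⇒termOK : ∀ {ts} → All Admissible ts → All termOK (map rawT ts)
  Admissibles⇒termOK []             = []
  Admissibles⇒termOK {t ∷ _} (i ∷ is) = Admissible⇒termOK t i ∷ Admissibles⇒termOK is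
  raw-mono≈ : ∀ η ts → (∀ m → coeff (mono η) m ≈K coeff (Σterm termTop ts) m) →
              monoM η ≈M sumM (map termα (map rawT ts))
  raw-mono≈ η ts η≈ = ≡.subst (monoM η ≈M_) (raw-Σterm raw-termTop ts) (coeffM-≈ (mono η) (Σterm termTop ts) η≈)
  raw-bar≈ : ∀ ts → raw (Σterm termBar ts) ≈M sumM (map termrδ (map rawT ts))
  raw-bar≈ ts = ≡.subst (raw (Σterm termBar ts) ≈M_) (raw-Σterm raw-termBar ts) (≈M-refl (raw (Σterm termBar ts)))
  expansion⇒barMono : ∀ η →
    (∃ λ ts → All Admissible ts × (∀ m → coeff (mono η) m ≈K coeff (Σterm termTop ts) m)) →
    Σ (MPoly n) λ g → ValidM g × IsBarMono η g
  expansion⇒barMono η (ts , ok , η≈) =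
    raw (Σterm termBar ts) , raw-valid (Σterm termBar ts) , map rawT ts
    , Admissibles⇒termOK ok , raw-mono≈ η ts η≈ , raw-bar≈ ts
  barMono-exists : ∀ η → Σ (MPoly n) λ g → ValidM g × IsBarMono η g
  barMono-exists η = expansion⇒barMono η (mono-expansion η)
  raw-Cond : ∀ η p ts → All Admissible ts →
    monoM η ≈M sumM (map termα (map rawT ts)) → raw p ≈M sumM (map termrδ (map rawT ts)) → Cond η (raw p)
  raw-Cond η p ts ok η≈ p≈ = Characterised⇒Cond η p (bar-characterised η ts ok
    (≈M-coeff (mono η) (Σterm termTop ts) (≡.subst (monoM η ≈M_) (≡.sym (raw-Σterm raw-termTop ts)) η≈)) p
    (≈M-coeff p (Σterm termBar ts) (≡.subst (raw p ≈M_) (≡.sym (raw-Σterm raw-termBar ts)) p≈)))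

  barMono-Cond : ∀ η g → ValidM g → IsBarMono η g → Cond η g
  barMono-Cond η g validg (ts , oks , η≈ , g≈) =
    let p , e = ValidM⇒raw validg ; ss , ok , f = termOK⇒raw oks in
    ≡.subst (Cond η) e (raw-Cond η p ss ok
      (≡.subst (λ ts → monoM η ≈M sumM (map termα ts)) (≡.sym f) η≈)
      (≡.subst₂ (λ g ts → g ≈M sumM (map termrδ ts)) (≡.sym e) (≡.sym f) g≈))

  Cond-unique : ∀ η g h → ValidM g → ValidM h → Cond η g → Cond η h → g ≈M h
  Cond-unique η g h validg validh =
    let p , e = ValidM⇒raw validg ; q , f = ValidM⇒raw validh in
    ≡.subst₂ (λ g h → Cond η g → Cond η h → g ≈M h) e f λ condp condq → coeffM-≈ p q
      (characterised-unique η p q (Cond⇒Characterised η p condp) (Cond⇒Characterised η q condq))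

theorem3p11 : (n : ℕ) → 1 ≤ n → (η : Comp n)
    → (Σ (MPoly n) λ g → ValidM g × IsBarMono η g)
    × (∀ g → ValidM g → IsBarMono η g → Cond η g)
    × (∀ g h → ValidM g → ValidM h → Cond η g → Cond η h → g ≈M h)
theorem3p11 n _ η = barMono-exists η , barMono-Cond η , Cond-unique η
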